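{- Let $\alpha\in(0,1)$ be a fixed constant. There is an algorithm that, given local access to a directed graph $G=(V,E)$ with $n$ nodes and $m$ edges, maximum in-degree $\Delta_{\mathrm{in}}$ and maximum out-degree $\Delta_{\mathrm{out}}$, together with a target node $t\in V$ and a parameter $\epsilon\in(0,1)$, computes an $\epsilon$-approximation of the PageRank contribution vector for $t$ without using the $\mathrm{JUMP}()$ query, with computational complexity $$O\left(\frac{n\pi(t)}{\epsilon}\cdot\min\left(\Delta_{\mathrm{in}},\Delta_{\mathrm{out}},\sqrt{m}\right)\right).$$
   Context: Graphs: $G=(V,E)$ is a directed graph with $n=|V|$, $m=|E|$, $E\subseteq V\times V$, in which every node has nonzero out-degree. If $(u,v)\in E$ then $u$ is a parent of $v$ and $v$ is a child of $u$. $d_{\mathrm{in}}(v)$ and $d_{\mathrm{out}}(v)$ are the in-degree and out-degree of $v$; $\Delta_{\mathrm{in}}=\max_{v}d_{\mathrm{in}}(v)$ and $\Delta_{\mathrm{out}}=\max_v d_{\mathrm{out}}(v)$. PageRank: the decay factor $\alpha\in(0,1)$ is a fixed constant (constants hidden in $O(\cdot)$ may depend on it). An $\alpha$-discounted random walk from $u$ starts at $u$, moves to a uniformly random child of the current node at each step, and has random length equal to $\ell$ with probability $\alpha(1-\alpha)^{\ell}$ for each $\ell\ge 0$. $\pi(u,v)$ is the probability that an $\alpha$-discounted random walk from $u$ terminates at $v$ (the PageRank contribution of $u$ to $v$). The PageRank score of $t$ is $\pi(t)=\frac1n\sum_{u\in V}\pi(u,t)$. The PageRank contribution vector for $t$ is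 the $n$-dimensional vector $(\pi(v,t))_{v\in V}$. An $\epsilon$-approximation of it is a (sparsely represented) vector whose difference from the contribution vector is at most $\epsilon$ in absolute value at each node. Model (arc-centric graph-access model): computational complexity is measured in the standard RAM model, where the graph is accessed only through an oracle supporting in unit time the queries $\mathrm{INDEG}(v)$ (returns $d_{\mathrm{in}}(v)$), $\mathrm{OUTDEG}(v)$ (returns $d_{\mathrm{out}}(v)$), $\mathrm{PARENT}(v,i)$ (returns the $i$-th parent of $v$), $\mathrm{CHILD}(v,i)$ (returns the $i$-th child of $v$), and the global query $\mathrm{JUMP}()$ (returns a uniformly random node of $V$). "Without using $\mathrm{JUMP}()$" means only the other four (local) queries are used. -}

module Defs where

open import Algebra.Bundles using (CommutativeRing)
open import Algebra.Structures using (IsCommutativeRing)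
import Algebra.Construct.NaturalChoice.Max as NaturalMax
import Algebra.Construct.NaturalChoice.Min as NaturalMin
import Algebra.Properties.Semiring.Exp as Exp
import Algebra.Properties.Semiring.Mult as Mult
open import Data.Bool.Base using (Bool; true; false; not; if_then_else_)
open import Data.Fin.Base using (Fin; toℕ)
open import Data.Fin.Properties using () renaming (_≟_ to _≟ᶠ_)
open import Data.List.Base
  using (List; []; _∷_; map; foldr; filter; length; lookup; upTo; allFin; cartesianProduct)
open import Data.List.Extrema.Nat using (max)
open import Data.List.Membership.Propositional using (_∉_)
open import Data.List.Relation.Binary.Permutation.Propositional using (_↭_)
open import Data.List.Relation.Unary.Unique.Propositional using (Unique)
open import Data.Nat.Base as ℕ using (ℕ; zero; suc)
import Data.Nat.Properties as ℕ
open import Data.Product.Base using (Σ-syntax; ∃-syntax; _×_; _,_; uncurry)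
open import Relation.Binary.Bundles using (DecTotalOrder)
open import Relation.Binary.Core using (Rel)
open import Relation.Binary.Definitions using (Decidable)
open import Relation.Binary.PropositionalEquality using (_≡_; _≢_)
open import Relation.Binary.Structures using (IsDecTotalOrder)
open import Relation.Nullary.Decidable using (does; _×-dec_)
open import Level using (0ℓ)

------------------------------------------------------------------------
-- Real numbers
--
-- The library has no real numbers, so they are axiomatised: `Reals` below
-- describes complete Archimedean ordered fields, i.e. ℝ up to isomorphism.
-- The order is decidable, as exact real comparisons are in the RAM model;
-- a model therefore exists classically, not constructively.

record OrderedField : Set₁ where
  infix  8 _⁻¹
  infix  8 -_
  infixl 7 _*_
  infixl 6 _+_ _-_
  infix  4 _≤_ _<_
  field
    ℝ                 : Set
    _+_ _*_           : ℝ → ℝ → ℝ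
    -_ _⁻¹            : ℝ → ℝ
    0# 1#             : ℝ
    _≤_               : Rel ℝ 0ℓ
    isCommutativeRing : IsCommutativeRing _≡_ _+_ _*_ -_ 0# 1#
    isDecTotalOrder   : IsDecTotalOrder _≡_ _≤_
    0≢1               : 0# ≢ 1#
    -- The inverse is total; its value at 0 is left unspecified.
    *-inverseʳ        : ∀ x → x ≢ 0# → x * x ⁻¹ ≡ 1#
    +-monoʳ-≤         : ∀ x {y z} → y ≤ z → x + y ≤ x + z
    *-nonneg          : ∀ {x y} → 0# ≤ x → 0# ≤ y → 0# ≤ x * y

  commutativeRing : CommutativeRing 0ℓ 0ℓ
  commutativeRing = record { isCommutativeRing = isCommutativeRing }

  decTotalOrder : DecTotalOrder 0ℓ 0ℓ 0ℓ
  decTotalOrder = record { isDecTotalOrder = isDecTotalOrder }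

  open CommutativeRing commutativeRing public using (semiring)
  open DecTotalOrder decTotalOrder public using (_≤?_; totalOrder)
  open Exp semiring public using (_^_)
  open NaturalMin totalOrder public using (_⊓_)
  open NaturalMax totalOrder public using (_⊔_)

  _-_ : ℝ → ℝ → ℝ
  x - y = x + (- y)

  _<_ : Rel ℝ 0ℓ
  x < y = x ≤ y × x ≢ y

  ∣_∣ : ℝ → ℝ
  ∣ x ∣ = x ⊔ (- x)

  fromℕ : ℕ → ℝ
  fromℕ k = k Mult× 1#
    where open Mult semiring using () renaming (_×_ to _Mult×_)

  ∑ : {A : Set} → List A → (A → ℝ) → ℝ
  ∑ xs f = foldr _+_ 0# (map f xs)

record Reals : Set₁ where
  field
    orderedField : OrderedField
  open OrderedField orderedField public
  field
    archimedean : ∀ x → ∃[ k ] x ≤ fromℕ k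
    -- The supremum of a sequence; unspecified if the sequence is unbounded.
    sup         : (ℕ → ℝ) → ℝ
    sup-upper   : ∀ f b → (∀ i → f i ≤ b) → ∀ i → f i ≤ sup f
    sup-least   : ∀ f b → (∀ i → f i ≤ b) → sup f ≤ b
    -- Follows from completeness; unspecified on negative numbers.
    √_          : ℝ → ℝ
    √-nonneg    : ∀ {x} → 0# ≤ x → 0# ≤ √ x
    √-square    : ∀ {x} → 0# ≤ x → √ x * √ x ≡ x

  -- The sum of a series of nonnegative terms.
  ∑∞ : (ℕ → ℝ) → ℝ
  ∑∞ f = sup λ k → ∑ (upTo k) f

------------------------------------------------------------------------
-- Graphs

record Graph : Set₁ where
  field
    n  : ℕ
    E  : Rel (Fin n) 0ℓ
    E? : Decidable E

  V : Set
  V = Fin n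

  inNbrs : V → List V
  inNbrs v = filter (λ u → E? u v) (allFin n)

  outNbrs : V → List V
  outNbrs u = filter (λ v → E? u v) (allFin n)

  dᵢₙ : V → ℕ
  dᵢₙ v = length (inNbrs v)

  dₒᵤₜ : V → ℕ
  dₒᵤₜ u = length (outNbrs u)

  field
    dₒᵤₜ≢0 : ∀ u → dₒᵤₜ u ≢ 0

  m : ℕ
  m = length (filter (λ (u , v) → E? u v) (cartesianProduct (allFin n) (allFin n)))

  Δᵢₙ Δₒᵤₜ : ℕ
  Δᵢₙ  = max 0 (map dᵢₙ (allFin n))
  Δₒᵤₜ = max 0 (map dₒᵤₜ (allFin n))

-- The orders in which the oracle enumerates parents and children.
record Access (G : Graph) : Set where
  open Graph G
  field
    parents children : V → List V
    parents↭         : ∀ v → parents v ↭ inNbrs v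
    children↭        : ∀ u → children u ↭ outNbrs u

------------------------------------------------------------------------
-- PageRank

module PageRank (ℛ : Reals) (α : Reals.ℝ ℛ) (G : Graph) where
  open Reals ℛ
  open Graph G

  -- The probability that the ℓ-step random walk from u ends at v.
  walk : ℕ → V → V → ℝ
  walk zero    u v = if does (u ≟ᶠ v) then 1# else 0#
  walk (suc ℓ) u v = ∑ (outNbrs u) λ w → fromℕ (dₒᵤₜ u) ⁻¹ * walk ℓ w v

  π : V → V → ℝ
  π u v = ∑∞ λ ℓ → (α * (1# - α) ^ ℓ) * walk ℓ u v

  pageRank : V → ℝ
  pageRank t = fromℕ n ⁻¹ * ∑ (allFin n) λ u → π u t

  -- A sparse representation of x lists, without repetition, the nodes of
  -- some set together with their values; x is zero at all other nodes.
  Represents : List (ℕ × ℝ) → (V → ℝ) → Set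
  Represents out x = Σ[ support ∈ List V ]
    ( Unique support
    × out ≡ map (λ v → toℕ v , x v) support
    × (∀ v → v ∉ support → x v ≡ 0#) )

  ApproximatesContributions : List (ℕ × ℝ) → V → ℝ → Set
  ApproximatesContributions out t ε = Σ[ x ∈ (V → ℝ) ]
    ( Represents out x
    × (∀ v → ∣ x v - π v t ∣ ≤ ε) )

------------------------------------------------------------------------
-- RAM programs
--
-- A random access machine with integer memory, real memory and a write-only
-- output tape.  Each memory consists of arrays indexed by ℕ; a program names
-- finitely many of them.  Integer operations are addition and truncated
-- subtraction only, and no operation converts reals to integers, so that
-- unit cost cannot be exploited by packing data into large integers.
-- There is no JUMP instruction.

infixl 6 _⊕_ _⊖_
infixl 7 _⊗_ _⊘_
infix  4 _≤ⁱ_ _≤ʳ_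
infixr 1 _⨾_

data IExp : Set where
  lit     : ℕ → IExp
  int     : (a : ℕ) (i : IExp) → IExp
  _⊕_ _⊖_ : IExp → IExp → IExp

data RExp : Set where
  real            : (a : ℕ) (i : IExp) → RExp
  ofInt           : IExp → RExp
  _⊕_ _⊖_ _⊗_ _⊘_ : RExp → RExp → RExp

data Test : Set where
  _≤ⁱ_ : IExp → IExp → Test
  _≤ʳ_ : RExp → RExp → Test
  neg  : Test → Test

data Cmd : Set where
  skip           : Cmd
  setInt         : (a : ℕ) (i : IExp) → IExp → Cmd
  setReal        : (a : ℕ) (i : IExp) → RExp → Cmd
  indeg outdeg   : (a : ℕ) (i : IExp) (v : IExp) → Cmd
  parent child   : (a : ℕ) (i : IExp) (v k : IExp) → Cmd
  write          : IExp → RExp → Cmd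
  _⨾_            : Cmd → Cmd → Cmd
  ifThenElse     : Test → Cmd → Cmd → Cmd
  while          : Test → Cmd → Cmd

-- Costs count every operation, including memory accesses and literals.

icost : IExp → ℕ
icost (lit _)   = 1
icost (int _ i) = suc (icost i)
icost (d ⊕ e)   = suc (icost d ℕ.+ icost e)
icost (d ⊖ e)   = suc (icost d ℕ.+ icost e)

rcost : RExp → ℕ
rcost (real _ i) = suc (icost i)
rcost (ofInt e)  = suc (icost e)
rcost (x ⊕ y)    = suc (rcost x ℕ.+ rcost y)
rcost (x ⊖ y)    = suc (rcost x ℕ.+ rcost y)
rcost (x ⊗ y)    = suc (rcost x ℕ.+ rcost y)
rcost (x ⊘ y)    = suc (rcost x ℕ.+ rcost y)

tcost : Test → ℕ
tcost (d ≤ⁱ e) = suc (icost d ℕ.+ icost e)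
tcost (x ≤ʳ y) = suc (rcost x ℕ.+ rcost y)
tcost (neg b)  = suc (tcost b)

update : {A : Set} → (ℕ → ℕ → A) → ℕ → ℕ → A → (ℕ → ℕ → A)
update mem a i x b j = if does ((b ℕ.≟ a) ×-dec (j ℕ.≟ i)) then x else mem b j

module Machine (ℛ : Reals) where
  open Reals ℛ

  record State : Set where
    constructor state
    field
      ints   : ℕ → ℕ → ℕ
      reals  : ℕ → ℕ → ℝ
      output : List (ℕ × ℝ)

  open State public

  ieval : State → IExp → ℕ
  ieval σ (lit k)   = k
  ieval σ (int a i) = ints σ a (ieval σ i)
  ieval σ (d ⊕ e)   = ieval σ d ℕ.+ ieval σ e
  ieval σ (d ⊖ e)   = ieval σ d ℕ.∸ ieval σ e

  reval : State → RExp → ℝ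
  reval σ (real a i) = reals σ a (ieval σ i)
  reval σ (ofInt e)  = fromℕ (ieval σ e)
  reval σ (x ⊕ y)    = reval σ x + reval σ y
  reval σ (x ⊖ y)    = reval σ x - reval σ y
  reval σ (x ⊗ y)    = reval σ x * reval σ y
  reval σ (x ⊘ y)    = reval σ x * reval σ y ⁻¹

  teval : State → Test → Bool
  teval σ (d ≤ⁱ e) = does (ieval σ d ℕ.≤? ieval σ e)
  teval σ (x ≤ʳ y) = does (reval σ x ≤? reval σ y)
  teval σ (neg b)  = not (teval σ b)

  putInt : State → ℕ → IExp → ℕ → State
  putInt σ a i k = record σ { ints = update (ints σ) a (ieval σ i) k }

  putReal : State → ℕ → IExp → ℝ → State
  putReal σ a i x = record σ { reals = update (reals σ) a (ieval σ i) x }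

  -- Memory is initially zero except for the input: the target node and the
  -- two real parameters.
  initial : ℕ → ℝ → ℝ → State
  initial t ε α = state
    (update (λ _ _ → 0) 0 0 t)
    (update (update (λ _ _ → 0#) 0 0 ε) 0 1 α)
    []

  module Execution {G : Graph} (A : Access G) where
    open Graph G
    open Access A

    -- ⟨ c , σ ⟩⇓[ k ] τ: started in σ, the program c halts in τ at cost k.
    -- Nodes are represented by their indices, and parents and children are
    -- numbered from 0.  An oracle query whose arguments are not a node or
    -- are out of range gets stuck.
    infix 4 ⟨_,_⟩⇓[_]_

    data ⟨_,_⟩⇓[_]_ : Cmd → State → ℕ → State → Set where
      skip : ∀ {σ} → ⟨ skip , σ ⟩⇓[ 1 ] σ

      setInt : ∀ {σ a i e} →
        ⟨ setInt a i e , σ ⟩⇓[ suc (icost i ℕ.+ icost e) ] putInt σ a i (ieval σ e)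

      setReal : ∀ {σ a i x} →
        ⟨ setReal a i x , σ ⟩⇓[ suc (icost i ℕ.+ rcost x) ] putReal σ a i (reval σ x)

      indeg : ∀ {σ a i e} (v : V) → ieval σ e ≡ toℕ v →
        ⟨ indeg a i e , σ ⟩⇓[ suc (icost i ℕ.+ icost e) ] putInt σ a i (dᵢₙ v)

      outdeg : ∀ {σ a i e} (v : V) → ieval σ e ≡ toℕ v →
        ⟨ outdeg a i e , σ ⟩⇓[ suc (icost i ℕ.+ icost e) ] putInt σ a i (dₒᵤₜ v)

      parent : ∀ {σ a i d e} (v : V) (k : Fin (length (parents v))) →
        ieval σ d ≡ toℕ v → ieval σ e ≡ toℕ k →
        ⟨ parent a i d e , σ ⟩⇓[ suc (icost i ℕ.+ icost d ℕ.+ icost e) ]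
          putInt σ a i (toℕ (lookup (parents v) k))

      child : ∀ {σ a i d e} (v : V) (k : Fin (length (children v))) →
        ieval σ d ≡ toℕ v → ieval σ e ≡ toℕ k →
        ⟨ child a i d e , σ ⟩⇓[ suc (icost i ℕ.+ icost d ℕ.+ icost e) ]
          putInt σ a i (toℕ (lookup (children v) k))

      write : ∀ {σ e x} →
        ⟨ write e x , σ ⟩⇓[ suc (icost e ℕ.+ rcost x) ]
          record σ { output = (ieval σ e , reval σ x) ∷ output σ }

      _⨾_ : ∀ {c d ρ σ τ j k} →
        ⟨ c , ρ ⟩⇓[ j ] σ → ⟨ d , σ ⟩⇓[ k ] τ → ⟨ c ⨾ d , ρ ⟩⇓[ j ℕ.+ k ] τ

      if-true : ∀ {b c d σ τ k} → teval σ b ≡ true →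
        ⟨ c , σ ⟩⇓[ k ] τ → ⟨ ifThenElse b c d , σ ⟩⇓[ tcost b ℕ.+ k ] τ

      if-false : ∀ {b c d σ τ k} → teval σ b ≡ false →
        ⟨ d , σ ⟩⇓[ k ] τ → ⟨ ifThenElse b c d , σ ⟩⇓[ tcost b ℕ.+ k ] τ

      while-true : ∀ {b c ρ σ τ j k} → teval ρ b ≡ true →
        ⟨ c , ρ ⟩⇓[ j ] σ → ⟨ while b c , σ ⟩⇓[ k ] τ →
        ⟨ while b c , ρ ⟩⇓[ tcost b ℕ.+ j ℕ.+ k ] τ

      while-false : ∀ {b c σ} → teval σ b ≡ false →
        ⟨ while b c , σ ⟩⇓[ tcost b ] σ

{-# OPTIONS --safe #-}
-- The algorithm is backward push.  It keeps reserves p and residues r with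
--     p u + α r u = α [u = t] + (1 − α) avg p,    avg over the children of u,
-- and repeatedly moves a residue exceeding ε at v: α times it joins p v, the
-- rest is passed on to the parents of v.  The contributions πₜ solve the same
-- equation with r = 0, so a maximum principle gives p ≤ πₜ whenever r ≥ 0, and
-- πₜ ≤ p + ε once r ≤ ε.
--
-- A push at v costs O(1 + dᵢₙ v) and raises p v by at least α ε, so the total
-- cost is O(Σ πₜ v (1 + dᵢₙ v) / (α ε)).  Finally Σ πₜ v dᵢₙ v sums, over all u,
-- the values of πₜ at the children of u.  For each u these add up to at most
-- dₒᵤₜ u πₜ u / (1 − α), which is used where dₒᵤₜ u ≤ √m, and to at most Σ πₜ,
-- which is used at the at most √m remaining nodes.
module Submission where

import Algebra.Construct.NaturalChoice.Max as NaturalMax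
import Algebra.Construct.NaturalChoice.MaxOp as MaxOp
import Algebra.Construct.NaturalChoice.Min as NaturalMin
import Algebra.Construct.NaturalChoice.MinOp as MinOp
import Algebra.Properties.Ring as RingProperties
import Algebra.Properties.Semiring.Mult as Mult
import Algebra.Solver.Ring.NaturalCoefficients.Default as SemiringSolver
open import Algebra.Bundles using (CommutativeRing)
open import Data.Bool.Base using (true; false; if_then_else_)
open import Data.Fin.Base using (Fin; toℕ; fromℕ<; zero; suc)
open import Data.Fin.Properties using (toℕ-injective; toℕ-fromℕ<) renaming (_≟_ to _≟ᶠ_)
open import Data.List.Base
  using (List; []; _∷_; _++_; map; filter; length; lookup; allFin; drop; upTo; applyUpTo; cartesianProduct)
import Data.List.Extrema as Extrema
open import Data.List.Extrema.Nat using (xs≤max)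
open import Data.List.Membership.Propositional using (_∈_; _∉_)
open import Data.List.Membership.Propositional.Properties
  using (∈-allFin; ∈-filter⁺; ∈-filter⁻; ∈-map⁺; ∈-length)
open import Data.List.Properties using (drop-all)
open import Data.List.Relation.Binary.Permutation.Propositional as Perm using (_↭_)
open import Data.List.Relation.Binary.Permutation.Propositional.Properties using (↭-length)
open import Data.List.Relation.Unary.All as All using (All; []; _∷_)
open import Data.List.Relation.Unary.All.Properties using (¬Any⇒All¬)
open import Data.List.Relation.Unary.AllPairs using ([]; _∷_)
open import Data.List.Relation.Unary.Any using (here; there)
open import Data.List.Relation.Unary.Unique.Propositional using (Unique)
open import Data.List.Relation.Unary.Unique.Propositional.Properties using (allFin⁺)
open import Data.Nat.Base as ℕ using (ℕ; zero; suc)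
import Data.Nat.Properties as ℕ
import Data.Nat.Solver as ℕSolver
open import Data.Product.Base using (_×_; _,_; proj₁; proj₂; ∃-syntax; Σ-syntax; uncurry)
open import Data.Sum.Base using (_⊎_; inj₁; inj₂; map₂)
open import Function.Base using (_∘_)
open import Relation.Binary.Bundles using (DecTotalOrder)
open import Relation.Binary.Definitions using (DecidableEquality)
open import Relation.Binary.PropositionalEquality
  using (_≡_; _≢_; refl; sym; trans; cong; cong₂; subst; subst₂)
import Relation.Binary.Reasoning.PartialOrder as PartialOrderReasoning
open import Relation.Nullary.Decidable using (Dec; yes; no; does; dec-true; dec-false; _×-dec_)
open import Relation.Nullary.Negation using (¬_; contradiction)
open import Relation.Unary using (Pred; Decidable)
open import Defs

-- The usual invariant of backward push involves `π u v` for every `v`. The local equation involves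
-- only `πₜ`, so a push is verified by linear arithmetic at each node. The residues above `ε` have
-- to be found without scanning all nodes. Every visited parent is therefore appended to a queue,
-- with no check for duplicates, and an entry whose residue turns out to be small is discarded.
-- Discarding and reporting an entry take constant time, prepaid by the push that created it.
-- Processed cells are never overwritten, so the same queue also lists the nodes to report. Neither
-- the number of pushes nor the number of iterations is known in advance. The cost so far is bounded
-- at every moment, and each iteration costs at least 1, which gives termination along with the
-- running time. Suprema are available only through their universal property, so the equation for
-- `πₜ` needs an exchange of a supremum with a finite sum.

-- Ordered-field arithmetic and finite sums

module OrderedFieldProperties (F : OrderedField) where
  open OrderedField F
  open CommutativeRing commutativeRing public
    using ( ring; commutativeSemiring; +-assoc; +-comm; +-identityˡ; +-identityʳ; -‿inverseʳ; -‿inverseˡ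
          ; *-assoc; *-comm; *-identityˡ; *-identityʳ; distribˡ; distribʳ; zeroˡ; zeroʳ)
  open DecTotalOrder decTotalOrder public using (poset)
    renaming (refl to ≤-refl; reflexive to ≤-reflexive; trans to ≤-trans; antisym to ≤-antisym; total to ≤-total)
  module Solver = SemiringSolver commutativeSemiring
  open Solver using (solve; _:+_; _:*_; _:=_)
  module ≤-Reasoning = PartialOrderReasoning poset
  open ≤-Reasoning

  ≰⇒≥ : ∀ {x y} → ¬ x ≤ y → y ≤ x
  ≰⇒≥ {x} {y} x≰y with ≤-total x y
  ... | inj₁ x≤y = contradiction x≤y x≰y
  ... | inj₂ y≤x = y≤x

  +-mono-≤ : ∀ {a b c d} → a ≤ b → c ≤ d → a + c ≤ b + d
  +-mono-≤ {a} {b} {c} {d} a≤b c≤d = begin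
    a + c ≤⟨ +-monoʳ-≤ a c≤d ⟩
    a + d ≡⟨ +-comm a d ⟩
    d + a ≤⟨ +-monoʳ-≤ d a≤b ⟩
    d + b ≡⟨ +-comm d b ⟩
    b + d ∎

  -x+[x+y]≡y : ∀ x y → - x + (x + y) ≡ y
  -x+[x+y]≡y x y = trans (sym (+-assoc _ _ _)) (trans (cong (_+ y) (-‿inverseˡ x)) (+-identityˡ y))

  x+[y-x]≡y : ∀ x y → x + (y - x) ≡ y
  x+[y-x]≡y x y = trans (cong (x +_) (+-comm y _))
    (trans (sym (+-assoc _ _ _)) (trans (cong (_+ y) (-‿inverseʳ x)) (+-identityˡ y)))

  +-cancelˡ-≤ : ∀ x {y z} → x + y ≤ x + z → y ≤ z
  +-cancelˡ-≤ x {y} {z} le = subst₂ _≤_ (-x+[x+y]≡y x y) (-x+[x+y]≡y x z) (+-monoʳ-≤ (- x) le)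

  x+y≤z⇒y≤z-x : ∀ x {y z} → x + y ≤ z → y ≤ z - x
  x+y≤z⇒y≤z-x x {z = z} le = +-cancelˡ-≤ x (subst (_ ≤_) (sym (x+[y-x]≡y x z)) le)

  y≤z-x⇒x+y≤z : ∀ x {y z} → y ≤ z - x → x + y ≤ z
  y≤z-x⇒x+y≤z x {z = z} le = subst (_ ≤_) (x+[y-x]≡y x z) (+-monoʳ-≤ x le)

  x≤x+y : ∀ x {y} → 0# ≤ y → x ≤ x + y
  x≤x+y x {y} 0≤y = subst (_≤ x + y) (+-identityʳ x) (+-monoʳ-≤ x 0≤y)

  x≤y+x : ∀ x {y} → 0# ≤ y → x ≤ y + x
  x≤y+x x {y} 0≤y = subst (x ≤_) (+-comm x y) (x≤x+y x 0≤y)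

  +-nonneg : ∀ {x y} → 0# ≤ x → 0# ≤ y → 0# ≤ x + y
  +-nonneg {x} 0≤x 0≤y = ≤-trans 0≤x (x≤x+y x 0≤y)

  x≤y⇒0≤y-x : ∀ {x y} → x ≤ y → 0# ≤ y - x
  x≤y⇒0≤y-x {x} x≤y = x+y≤z⇒y≤z-x x (subst (_≤ _) (sym (+-identityʳ x)) x≤y)

  *-monoʳ-≤ : ∀ {c x y} → 0# ≤ c → x ≤ y → c * x ≤ c * y
  *-monoʳ-≤ {c} {x} {y} 0≤c x≤y = begin
    c * x                 ≤⟨ x≤x+y _ (*-nonneg 0≤c (x≤y⇒0≤y-x x≤y)) ⟩
    c * x + c * (y - x)   ≡⟨ distribˡ c x (y - x) ⟨
    c * (x + (y - x))     ≡⟨ cong (c *_) (x+[y-x]≡y x y) ⟩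
    c * y                 ∎

  *-monoˡ-≤ : ∀ {c x y} → 0# ≤ c → x ≤ y → x * c ≤ y * c
  *-monoˡ-≤ {c} {x} {y} 0≤c x≤y = subst₂ _≤_ (*-comm c x) (*-comm c y) (*-monoʳ-≤ 0≤c x≤y)

  *-inverseˡ : ∀ {x} → x ≢ 0# → x ⁻¹ * x ≡ 1#
  *-inverseˡ x≢0 = trans (*-comm _ _) (*-inverseʳ _ x≢0)

  0≤1 : 0# ≤ 1#
  0≤1 with ≤-total 0# 1#
  ... | inj₁ 0≤1 = 0≤1
  ... | inj₂ 1≤0 = subst (0# ≤_) -1*-1≡1 (*-nonneg 0≤-1 0≤-1)
    where
    open RingProperties ring using (-1*x≈-x; -‿involutive)
    0≤-1 : 0# ≤ - 1#
    0≤-1 = subst (0# ≤_) (+-identityˡ (- 1#)) (x≤y⇒0≤y-x 1≤0)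
    -1*-1≡1 : - 1# * - 1# ≡ 1#
    -1*-1≡1 = trans (-1*x≈-x (- 1#)) (-‿involutive 1#)

  <⇒≤ : ∀ {x y} → x < y → x ≤ y
  <⇒≤ = proj₁

  0<⇒≢0 : ∀ {x} → 0# < x → x ≢ 0#
  0<⇒≢0 (_ , 0≢x) = 0≢x ∘ sym

  x<y⇒0<y-x : ∀ {x y} → x < y → 0# < y - x
  x<y⇒0<y-x {x} {y} (x≤y , x≢y) = x≤y⇒0≤y-x x≤y , λ eq → x≢y
    (trans (sym (+-identityʳ x)) (trans (cong (x +_) eq) (x+[y-x]≡y x y)))

  *-cancelˡ-≡ : ∀ {c x y} → c ≢ 0# → c * x ≡ c * y → x ≡ y
  *-cancelˡ-≡ {c} {x} {y} c≢0 eq = trans (sym (c⁻¹cz≡z x)) (trans (cong (c ⁻¹ *_) eq) (c⁻¹cz≡z y))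
    where
    c⁻¹cz≡z : ∀ z → c ⁻¹ * (c * z) ≡ z
    c⁻¹cz≡z z = trans (sym (*-assoc _ _ _)) (trans (cong (_* z) (*-inverseˡ c≢0)) (*-identityˡ z))

  *-cancelˡ-≤ : ∀ {c x y} → 0# < c → c * x ≤ c * y → x ≤ y
  *-cancelˡ-≤ {c} {x} {y} 0<c cx≤cy with ≤-total x y
  ... | inj₁ x≤y = x≤y
  ... | inj₂ y≤x = ≤-reflexive
    (*-cancelˡ-≡ (0<⇒≢0 0<c) (≤-antisym cx≤cy (*-monoʳ-≤ (<⇒≤ 0<c) y≤x)))

  0<⇒0≤⁻¹ : ∀ {x} → 0# < x → 0# ≤ x ⁻¹
  0<⇒0≤⁻¹ {x} 0<x = *-cancelˡ-≤ 0<x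
    (subst₂ _≤_ (sym (zeroʳ x)) (sym (*-inverseʳ x (0<⇒≢0 0<x))) 0≤1)

  x*[x⁻¹*y]≡y : ∀ {x} y → x ≢ 0# → x * (x ⁻¹ * y) ≡ y
  x*[x⁻¹*y]≡y {x} y x≢0 =
    trans (sym (*-assoc _ _ _)) (trans (cong (_* y) (*-inverseʳ x x≢0)) (*-identityˡ y))

  *-pos : ∀ {x y} → 0# < x → 0# < y → 0# < x * y
  *-pos {x} {y} 0<x 0<y = *-nonneg (<⇒≤ 0<x) (<⇒≤ 0<y) , λ 0≡xy →
    0<⇒≢0 0<y (*-cancelˡ-≡ (0<⇒≢0 0<x) (trans (sym 0≡xy) (sym (zeroʳ x))))

  0<⇒0<⁻¹ : ∀ {x} → 0# < x → 0# < x ⁻¹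
  0<⇒0<⁻¹ {x} 0<x = 0<⇒0≤⁻¹ 0<x , λ 0≡x⁻¹ → 0≢1
    (trans (sym (zeroʳ x)) (trans (cong (x *_) 0≡x⁻¹) (*-inverseʳ x (0<⇒≢0 0<x))))

  ∣x-y∣≤z : ∀ {x y z} → x ≤ y + z → y ≤ x + z → ∣ x - y ∣ ≤ z
  ∣x-y∣≤z {x} {y} {z} x≤y+z y≤x+z with MaxOp.⊔-sel (NaturalMax.maxOperator totalOrder) (x - y) (- (x - y))
  ... | inj₁ eq = subst (_≤ z) (sym eq) (+-cancelˡ-≤ y (subst (_≤ y + z) (sym (x+[y-x]≡y y x)) x≤y+z))
  ... | inj₂ eq = subst (_≤ z) (sym (trans eq -[x-y]≡y-x))
    (+-cancelˡ-≤ x (subst (_≤ x + z) (sym (x+[y-x]≡y x y)) y≤x+z))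
    where
    open RingProperties ring using (-‿anti-homo-+; -‿involutive)
    -[x-y]≡y-x : - (x - y) ≡ y - x
    -[x-y]≡y-x = trans (-‿anti-homo-+ x (- y)) (cong (_+ - x) (-‿involutive y))

  open Mult semiring using (×-homo-+; ×1-homo-*)

  fromℕ-+ : ∀ a b → fromℕ (a ℕ.+ b) ≡ fromℕ a + fromℕ b
  fromℕ-+ = ×-homo-+ 1#

  fromℕ-* : ∀ a b → fromℕ (a ℕ.* b) ≡ fromℕ a * fromℕ b
  fromℕ-* = ×1-homo-*

  fromℕ-1 : fromℕ 1 ≡ 1#
  fromℕ-1 = +-identityʳ 1#

  fromℕ-nonneg : ∀ k → 0# ≤ fromℕ k
  fromℕ-nonneg zero    = ≤-refl
  fromℕ-nonneg (suc k) = +-nonneg 0≤1 (fromℕ-nonneg k)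

  fromℕ-mono-≤ : ∀ {j k} → j ℕ.≤ k → fromℕ j ≤ fromℕ k
  fromℕ-mono-≤ {k = k} ℕ.z≤n = fromℕ-nonneg k
  fromℕ-mono-≤ (ℕ.s≤s j≤k)   = +-monoʳ-≤ 1# (fromℕ-mono-≤ j≤k)

  fromℕ-cancel-≤ : ∀ {j k} → fromℕ j ≤ fromℕ k → j ℕ.≤ k
  fromℕ-cancel-≤ {zero}          _  = ℕ.z≤n
  fromℕ-cancel-≤ {suc j} {suc k} le = ℕ.s≤s (fromℕ-cancel-≤ (+-cancelˡ-≤ 1# le))
  fromℕ-cancel-≤ {suc j} {zero}  le =
    contradiction (≤-antisym 0≤1 (≤-trans (x≤x+y 1# (fromℕ-nonneg j)) le)) 0≢1

  fromℕ-pos : ∀ {k} → k ≢ 0 → 0# < fromℕ k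
  fromℕ-pos {k} k≢0 = fromℕ-nonneg k , λ eq →
    k≢0 (ℕ.n≤0⇒n≡0 (fromℕ-cancel-≤ (≤-reflexive (sym eq))))

  -- Unfolds to the very term that defines `walk zero`, so `⟦ u ≟ᶠ t ⟧` is the walk of length 0 by
  -- computation.
  ⟦_⟧ : ∀ {p} {P : Set p} → Dec P → ℝ
  ⟦ P? ⟧ = if does P? then 1# else 0#

  ⟦⟧-nonneg : ∀ {p} {P : Set p} (P? : Dec P) → 0# ≤ ⟦ P? ⟧
  ⟦⟧-nonneg (yes _) = 0≤1
  ⟦⟧-nonneg (no _)  = ≤-refl

  ⟦⟧≤1 : ∀ {p} {P : Set p} (P? : Dec P) → ⟦ P? ⟧ ≤ 1#
  ⟦⟧≤1 (yes _) = ≤-refl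
  ⟦⟧≤1 (no _)  = 0≤1

  module _ {A : Set} where

    ∑-cong : ∀ (xs : List A) {f g : A → ℝ} → (∀ x → f x ≡ g x) → ∑ xs f ≡ ∑ xs g
    ∑-cong []       f≗g = refl
    ∑-cong (x ∷ xs) f≗g = cong₂ _+_ (f≗g x) (∑-cong xs f≗g)

    ∑-mono-≤ : ∀ (xs : List A) {f g : A → ℝ} → (∀ x → f x ≤ g x) → ∑ xs f ≤ ∑ xs g
    ∑-mono-≤ []       f≤g = ≤-refl
    ∑-mono-≤ (x ∷ xs) f≤g = +-mono-≤ (f≤g x) (∑-mono-≤ xs f≤g)

    ∑-nonneg : ∀ (xs : List A) {f : A → ℝ} → (∀ x → 0# ≤ f x) → 0# ≤ ∑ xs f
    ∑-nonneg []       0≤f = ≤-refl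
    ∑-nonneg (x ∷ xs) 0≤f = +-nonneg (0≤f x) (∑-nonneg xs 0≤f)

    term≤∑ : ∀ {xs : List A} {x} {f : A → ℝ} → (∀ x → 0# ≤ f x) → x ∈ xs → f x ≤ ∑ xs f
    term≤∑ {f = f} 0≤f (here {xs = xs} refl) = x≤x+y _ (∑-nonneg xs 0≤f)
    term≤∑ {f = f} 0≤f (there {x = y} x∈xs)  = ≤-trans (term≤∑ 0≤f x∈xs) (x≤y+x _ (0≤f y))

    ∑-+ : ∀ (xs : List A) (f g : A → ℝ) → ∑ xs (λ x → f x + g x) ≡ ∑ xs f + ∑ xs g
    ∑-+ []       f g = sym (+-identityˡ 0#)
    ∑-+ (x ∷ xs) f g = trans (cong (f x + g x +_) (∑-+ xs f g))
      (solve 4 (λ a b c d → (a :+ b) :+ (c :+ d) := (a :+ c) :+ (b :+ d)) refl _ _ _ _)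

    ∑-*ˡ : ∀ c (xs : List A) (f : A → ℝ) → ∑ xs (λ x → c * f x) ≡ c * ∑ xs f
    ∑-*ˡ c []       f = sym (zeroʳ c)
    ∑-*ˡ c (x ∷ xs) f = trans (cong (c * f x +_) (∑-*ˡ c xs f)) (sym (distribˡ c _ _))

    ∑-*ʳ : ∀ c (xs : List A) (f : A → ℝ) → ∑ xs (λ x → f x * c) ≡ ∑ xs f * c
    ∑-*ʳ c xs f = trans (∑-cong xs (λ x → *-comm (f x) c)) (trans (∑-*ˡ c xs f) (*-comm c _))

    ∑-const : ∀ (xs : List A) c → ∑ xs (λ _ → c) ≡ fromℕ (length xs) * c
    ∑-const []       c = sym (zeroˡ c)
    ∑-const (x ∷ xs) c = trans (cong₂ _+_ (sym (*-identityˡ c)) (∑-const xs c)) (sym (distribʳ c 1# _))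

    ∑-zero : ∀ (xs : List A) → ∑ xs (λ _ → 0#) ≡ 0#
    ∑-zero xs = trans (∑-const xs 0#) (zeroʳ _)

    ∑-++ : ∀ (xs ys : List A) (f : A → ℝ) → ∑ (xs ++ ys) f ≡ ∑ xs f + ∑ ys f
    ∑-++ []       ys f = sym (+-identityˡ _)
    ∑-++ (x ∷ xs) ys f = trans (cong (f x +_) (∑-++ xs ys f)) (sym (+-assoc _ _ _))

    ∑-↭ : ∀ {xs ys : List A} (f : A → ℝ) → xs ↭ ys → ∑ xs f ≡ ∑ ys f
    ∑-↭ f Perm.refl           = refl
    ∑-↭ f (Perm.prep x p)     = cong (f x +_) (∑-↭ f p)
    ∑-↭ f (Perm.swap x y p)   = trans (cong (λ s → f x + (f y + s)) (∑-↭ f p))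
      (solve 3 (λ a b c → a :+ (b :+ c) := b :+ (a :+ c)) refl _ _ _)
    ∑-↭ f (Perm.trans p q)    = trans (∑-↭ f p) (∑-↭ f q)

    -- Turns a neighbourhood into indicator weights on a fixed list, after which sums over edges can
    -- be swapped.
    ∑-filter : ∀ {p} {P : Pred A p} (P? : Decidable P) (xs : List A) (f : A → ℝ) →
               ∑ (filter P? xs) f ≡ ∑ xs (λ x → ⟦ P? x ⟧ * f x)
    ∑-filter P? []       f = refl
    ∑-filter P? (x ∷ xs) f with does (P? x)
    ... | true  = cong₂ _+_ (sym (*-identityˡ _)) (∑-filter P? xs f)
    ... | false = trans (∑-filter P? xs f)
      (sym (trans (cong (_+ ∑ xs (λ x → ⟦ P? x ⟧ * f x)) (zeroˡ (f x))) (+-identityˡ _)))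

    fromℕ-length-filter : ∀ {p} {P : Pred A p} (P? : Decidable P) (xs : List A) →
                          fromℕ (length (filter P? xs)) ≡ ∑ xs (λ x → ⟦ P? x ⟧)
    fromℕ-length-filter P? xs = trans (sym (*-identityʳ _)) (trans (sym (∑-const (filter P? xs) 1#))
      (trans (∑-filter P? xs _) (∑-cong xs (λ x → *-identityʳ _))))

    ∑-δ-∉ : (_≟_ : DecidableEquality A) → ∀ xs (f : A → ℝ) z → All (z ≢_) xs →
            ∑ xs (λ x → f x * ⟦ x ≟ z ⟧) ≡ 0#
    ∑-δ-∉ _≟_ []       f z []          = refl
    ∑-δ-∉ _≟_ (x ∷ xs) f z (z≢x ∷ z∉xs) with x ≟ z
    ... | yes x≡z = contradiction (sym x≡z) z≢x
    ... | no  _   = trans (cong₂ _+_ (zeroʳ (f x)) (∑-δ-∉ _≟_ xs f z z∉xs)) (+-identityˡ 0#)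

    ∑-δ : (_≟_ : DecidableEquality A) → ∀ {xs} (f : A → ℝ) {z} → Unique xs → z ∈ xs →
          ∑ xs (λ x → f x * ⟦ x ≟ z ⟧) ≡ f z
    ∑-δ _≟_ {x ∷ xs} f {z} (x∉xs ∷ _) (here refl) with x ≟ x
    ... | yes _   = trans (cong₂ _+_ (*-identityʳ (f x)) (∑-δ-∉ _≟_ xs f x x∉xs)) (+-identityʳ (f x))
    ... | no x≢x  = contradiction refl x≢x
    ∑-δ _≟_ {x ∷ xs} f {z} (x∉xs ∷ u) (there z∈xs) with x ≟ z
    ... | yes refl = contradiction refl (All.lookup x∉xs z∈xs)
    ... | no _     = trans (cong₂ _+_ (zeroʳ (f x)) (∑-δ _≟_ f u z∈xs)) (+-identityˡ (f z))

  ∑-map : ∀ {A B : Set} (g : A → B) xs (f : B → ℝ) → ∑ (map g xs) f ≡ ∑ xs (f ∘ g)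
  ∑-map g []       f = refl
  ∑-map g (x ∷ xs) f = cong (f (g x) +_) (∑-map g xs f)

  module _ {A B : Set} where

    ∑-swap : ∀ (xs : List A) (ys : List B) (f : A → B → ℝ) →
             ∑ xs (λ x → ∑ ys (f x)) ≡ ∑ ys (λ y → ∑ xs (λ x → f x y))
    ∑-swap []       ys f = sym (∑-zero ys)
    ∑-swap (x ∷ xs) ys f =
      trans (cong (∑ ys (f x) +_) (∑-swap xs ys f)) (sym (∑-+ ys (f x) _))

    ∑-cartesianProduct : ∀ (xs : List A) (ys : List B) (f : A × B → ℝ) →
      ∑ (cartesianProduct xs ys) f ≡ ∑ xs (λ x → ∑ ys (λ y → f (x , y)))
    ∑-cartesianProduct []       ys f = refl
    ∑-cartesianProduct (x ∷ xs) ys f = trans (∑-++ (map (x ,_) ys) _ f)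
      (cong₂ _+_ (∑-map (x ,_) ys f) (∑-cartesianProduct xs ys f))

  -- The tail of `upTo (suc k)` computes to `applyUpTo suc k`; generalising `suc` to `g` makes the
  -- induction go through.
  ∑-applyUpTo : ∀ (g : ℕ → ℕ) k (f : ℕ → ℝ) → ∑ (applyUpTo g k) f ≡ ∑ (upTo k) (f ∘ g)
  ∑-applyUpTo g zero    f = refl
  ∑-applyUpTo g (suc k) f = cong (f (g 0) +_)
    (trans (∑-applyUpTo (g ∘ suc) k f) (sym (∑-applyUpTo suc k (f ∘ g))))

  ∑-upTo-suc : ∀ k (f : ℕ → ℝ) → ∑ (upTo (suc k)) f ≡ f 0 + ∑ (upTo k) (f ∘ suc)
  ∑-upTo-suc k f = cong (f 0 +_) (∑-applyUpTo suc k f)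

-- Exchanging suprema and finite sums

module Suprema (ℛ : Reals) where
  open Reals ℛ
  open OrderedFieldProperties orderedField
  open Solver using (solve; _:+_; _:*_; _:=_)

  module _ {A : Set} (S : ℕ → A → ℝ) (b : ℝ)
           (mono : ∀ {j k} → j ℕ.≤ k → ∀ x → S j x ≤ S k x)
           (bounded : ∀ k x → S k x ≤ b) where

    -- The suprema are removed one at a time: with `S j x` fixed for the head and moved into the
    -- offset `c`, the induction hypothesis handles the tail at an independent index `k`. By
    -- monotonicity both are dominated at the common index `j ℕ.⊔ k`.
    +∑-sup-least : ∀ xs {c z} → (∀ k → c + ∑ xs (S k) ≤ z) → c + ∑ xs (λ x → sup λ k → S k x) ≤ z
    +∑-sup-least []       le = le 0
    +∑-sup-least (x ∷ xs) {c} {z} le =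
      subst (_≤ z) (solve 3 (λ a b c → (b :+ a) :+ c := a :+ (b :+ c)) refl c _ _)
        (subst (_≤ z) (sym (+-assoc _ c _))
          (subst (_≤ z) (+-comm (c + s) _) (y≤z-x⇒x+y≤z (c + s) (sup-least _ _ λ j →
            x+y≤z⇒y≤z-x (c + s) (subst (_≤ z) (solve 3 (λ a b c → (a :+ b) :+ c := (a :+ c) :+ b) refl c _ _)
              (+∑-sup-least xs {c + S j x} λ k →
                ≤-trans (≤-reflexive (+-assoc c _ _))
                  (≤-trans (+-monoʳ-≤ c (+-mono-≤ (mono (ℕ.m≤m⊔n j k) x) (∑-mono-≤ xs (mono (ℕ.m≤n⊔m j k)))))
                    (le (j ℕ.⊔ k)))))))))
      where s = ∑ xs (λ x → sup λ k → S k x)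

    ∑-sup-least : ∀ xs {z} → (∀ k → ∑ xs (S k) ≤ z) → ∑ xs (λ x → sup λ k → S k x) ≤ z
    ∑-sup-least xs {z} le = subst (_≤ z) (+-identityˡ _)
      (+∑-sup-least xs λ k → subst (_≤ z) (sym (+-identityˡ _)) (le k))

-- Averages over children and the maximum principle

module Averages (ℛ : Reals) (G : Graph) where
  open Reals ℛ
  open Graph G
  open OrderedFieldProperties orderedField
  open Solver using (solve; _:+_; _:*_; _:=_)
  open ≤-Reasoning

  -- The weight stays inside the sum so that `walk (suc ℓ) u v` is, by computation, the average of
  -- `walk ℓ` over the children of `u`.
  avg : V → (V → ℝ) → ℝ
  avg u f = ∑ (outNbrs u) λ w → fromℕ (dₒᵤₜ u) ⁻¹ * f w

  0<dₒᵤₜ : ∀ u → 0# < fromℕ (dₒᵤₜ u)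
  0<dₒᵤₜ u = fromℕ-pos (dₒᵤₜ≢0 u)

  avg-mono-≤ : ∀ u {f g} → (∀ w → f w ≤ g w) → avg u f ≤ avg u g
  avg-mono-≤ u f≤g = ∑-mono-≤ (outNbrs u) λ w → *-monoʳ-≤ (0<⇒0≤⁻¹ (0<dₒᵤₜ u)) (f≤g w)

  avg-cong : ∀ u {f g} → (∀ w → f w ≡ g w) → avg u f ≡ avg u g
  avg-cong u f≗g = ∑-cong (outNbrs u) λ w → cong (fromℕ (dₒᵤₜ u) ⁻¹ *_) (f≗g w)

  avg-+ : ∀ u f g → avg u (λ w → f w + g w) ≡ avg u f + avg u g
  avg-+ u f g = trans (∑-cong (outNbrs u) λ w → distribˡ _ (f w) (g w)) (∑-+ (outNbrs u) _ _)

  avg-*ˡ : ∀ u c f → avg u (λ w → c * f w) ≡ c * avg u f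
  avg-*ˡ u c f = trans
    (∑-cong (outNbrs u) λ w → solve 3 (λ a b c → a :* (b :* c) := b :* (a :* c)) refl _ c (f w))
    (∑-*ˡ c (outNbrs u) _)

  avg-∑ : ∀ {A : Set} u (xs : List A) (f : A → V → ℝ) → avg u (λ w → ∑ xs λ x → f x w) ≡ ∑ xs (λ x → avg u (f x))
  avg-∑ u xs f = trans (∑-cong (outNbrs u) λ w → sym (∑-*ˡ _ xs _)) (∑-swap (outNbrs u) xs _)

  avg-const : ∀ u c → avg u (λ _ → c) ≡ c
  avg-const u c = trans (∑-const (outNbrs u) _) (x*[x⁻¹*y]≡y c (0<⇒≢0 (0<dₒᵤₜ u)))

  dₒᵤₜ*avg : ∀ u f → fromℕ (dₒᵤₜ u) * avg u f ≡ ∑ (outNbrs u) f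
  dₒᵤₜ*avg u f = trans (cong (fromℕ (dₒᵤₜ u) *_) (∑-*ˡ _ (outNbrs u) f))
    (x*[x⁻¹*y]≡y _ (0<⇒≢0 (0<dₒᵤₜ u)))

  avg-≟ : ∀ u v → avg u (λ w → ⟦ w ≟ᶠ v ⟧) ≡ fromℕ (dₒᵤₜ u) ⁻¹ * ⟦ E? u v ⟧
  avg-≟ u v = trans (∑-*ˡ _ (outNbrs u) _) (cong (fromℕ (dₒᵤₜ u) ⁻¹ *_)
    (trans (∑-filter (E? u) (allFin n) _) (∑-δ _≟ᶠ_ (λ w → ⟦ E? u w ⟧) (allFin⁺ n) (∈-allFin v))))

  ∑-inNbrs-≟ : ∀ u v → ∑ (inNbrs v) (λ w → ⟦ w ≟ᶠ u ⟧) ≡ ⟦ E? u v ⟧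
  ∑-inNbrs-≟ u v = trans (∑-filter (λ w → E? w v) (allFin n) _)
    (∑-δ _≟ᶠ_ (λ w → ⟦ E? w v ⟧) (allFin⁺ n) (∈-allFin u))

  module _ (α : ℝ) (0<α : 0# < α) (α<1 : α < 1#) where

    private β = 1# - α

    -- A maximum principle for f - g.
    comparison : ∀ c (f g : V → ℝ) →
                 (∀ u → f u + β * avg u g ≤ α * c + (g u + β * avg u f)) → ∀ u → f u ≤ g u + c
    comparison c f g hyp u = begin
      f u             ≤⟨ f≤g+d u ⟩
      g u + d         ≤⟨ +-monoʳ-≤ (g u) (*-cancelˡ-≤ 0<α αd≤αc) ⟩
      g u + c         ∎
      where
      open Extrema totalOrder using (argmax; f[xs]≤f[argmax])
      -- At a maximiser `z` with maximum `d`, `avg z f` is at most `avg z g + d`. The hypothesis at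
      -- `z` then gives `d ≤ β * d + α * c`, and `α + β` is 1. The start value `u` is harmless, as
      -- it is itself a node of `allFin n`.
      z = argmax (λ w → f w - g w) u (allFin n)
      d = f z - g z
      f≤g+d : ∀ w → f w ≤ g w + d
      f≤g+d w = subst (_≤ g w + d) (x+[y-x]≡y (g w) (f w)) (+-monoʳ-≤ (g w)
        (All.lookup (f[xs]≤f[argmax] u (allFin n)) (∈-allFin w)))
      αd≤αc : α * d ≤ α * c
      αd≤αc = +-cancelˡ-≤ (g z + β * avg z g + β * d) (begin
        g z + β * avg z g + β * d + α * d
          ≡⟨ solve 5 (λ x y z a b → x :+ y :+ b :* z :+ a :* z := (x :+ (a :+ b) :* z) :+ y) refl _ _ d α β ⟩
        g z + (α + β) * d + β * avg z g
          ≡⟨ cong (λ s → g z + s + β * avg z g) (trans (cong (_* d) (x+[y-x]≡y α 1#)) (*-identityˡ d)) ⟩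
        g z + d + β * avg z g
          ≡⟨ cong (_+ β * avg z g) (x+[y-x]≡y (g z) (f z)) ⟩
        f z + β * avg z g
          ≤⟨ hyp z ⟩
        α * c + (g z + β * avg z f)
          ≤⟨ +-monoʳ-≤ (α * c) (+-monoʳ-≤ (g z) (*-monoʳ-≤ (x≤y⇒0≤y-x (<⇒≤ α<1))
               (≤-trans (avg-mono-≤ z f≤g+d) (≤-reflexive
                 (trans (avg-+ z g _) (cong (avg z g +_) (avg-const z d))))))) ⟩
        α * c + (g z + β * (avg z g + d))
          ≡⟨ solve 5 (λ x y z a b → a :+ (x :+ b :* (y :+ z)) := x :+ b :* y :+ b :* z :+ a) refl (g z) (avg z g) d (α * c) β ⟩
        g z + β * avg z g + β * d + α * c
          ∎)

-- The equation for the contributions and its approximate solutions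

InUnitInterval : (ℛ : Reals) → Reals.ℝ ℛ → Set
InUnitInterval ℛ x = 0# < x × x < 1#
  where open Reals ℛ

module Contributions (ℛ : Reals) (α : Reals.ℝ ℛ) (α∈⟨0,1⟩ : InUnitInterval ℛ α)
                     (G : Graph) (t : Graph.V G) where
  open Reals ℛ
  open Graph G
  open PageRank ℛ α G
  open OrderedFieldProperties orderedField
  open Suprema ℛ
  open Averages ℛ G
  open Solver using (solve; _:+_; _:*_; _:=_)
  open ≤-Reasoning

  0<α : 0# < α
  0<α = proj₁ α∈⟨0,1⟩

  α<1 : α < 1#
  α<1 = proj₂ α∈⟨0,1⟩

  β : ℝ
  β = 1# - α

  0<β : 0# < β
  0<β = x<y⇒0<y-x α<1

  α+β≡1 : α + β ≡ 1#
  α+β≡1 = x+[y-x]≡y α 1#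

  source : V → ℝ
  source u = α * ⟦ u ≟ᶠ t ⟧

  source-nonneg : ∀ u → 0# ≤ source u
  source-nonneg u = *-nonneg (<⇒≤ 0<α) (⟦⟧-nonneg (u ≟ᶠ t))

  private
    S : ℕ → V → ℝ
    S k u = ∑ (upTo k) λ ℓ → (α * β ^ ℓ) * walk ℓ u t

    -- First-step decomposition: the term of length 0 is the source, and all others share a factor
    -- `β` and a first step to a child. Thus `S k` is the `k`-th iterate, from zero, of the map
    -- whose fixed point is `πₜ`.
    S-suc : ∀ k u → S (suc k) u ≡ source u + β * avg u (S k)
    S-suc k u = trans (∑-upTo-suc k _) (cong₂ _+_ (cong (_* ⟦ u ≟ᶠ t ⟧) (*-identityʳ α))
      (trans (∑-cong (upTo k) λ ℓ → trans
               (solve 4 (λ a b c d → (a :* (b :* c)) :* d := b :* ((a :* c) :* d)) refl α β (β ^ ℓ) _)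
               (cong (β *_) (sym (avg-*ˡ u (α * β ^ ℓ) (λ w → walk ℓ w t)))))
        (trans (∑-*ˡ β (upTo k) _) (cong (β *_) (sym (avg-∑ u (upTo k) _))))))

    step-mono-≤ : ∀ u {f g} → (∀ w → f w ≤ g w) → source u + β * avg u f ≤ source u + β * avg u g
    step-mono-≤ u f≤g = +-monoʳ-≤ (source u) (*-monoʳ-≤ (<⇒≤ 0<β) (avg-mono-≤ u f≤g))

    S-mono-≤ : ∀ {j k} → j ℕ.≤ k → ∀ u → S j u ≤ S k u
    S-mono-≤ {k = zero}  ℕ.z≤n u = ≤-refl
    S-mono-≤ {k = suc k} ℕ.z≤n u = subst (0# ≤_) (sym (S-suc k u)) (+-nonneg (source-nonneg u)
      (*-nonneg (<⇒≤ 0<β) (subst (_≤ avg u (S k)) (avg-const u 0#) (avg-mono-≤ u (S-mono-≤ {k = k} ℕ.z≤n)))))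
    S-mono-≤ {suc j} {suc k} (ℕ.s≤s j≤k) u =
      subst₂ _≤_ (sym (S-suc j u)) (sym (S-suc k u)) (step-mono-≤ u (S-mono-≤ j≤k))

    -- Supplies the bound that `sup-upper` requires. The constant 1 is preserved by the iteration
    -- because `α + β` is 1.
    S≤1 : ∀ k u → S k u ≤ 1#
    S≤1 zero    u = 0≤1
    S≤1 (suc k) u = begin
      S (suc k) u                 ≡⟨ S-suc k u ⟩
      source u + β * avg u (S k)  ≤⟨ +-mono-≤ (*-monoʳ-≤ (<⇒≤ 0<α) (⟦⟧≤1 (u ≟ᶠ t)))
                                       (*-monoʳ-≤ (<⇒≤ 0<β) (≤-trans (avg-mono-≤ u (S≤1 k)) (≤-reflexive (avg-const u 1#)))) ⟩
      α * 1# + β * 1#             ≡⟨ cong₂ _+_ (*-identityʳ α) (*-identityʳ β) ⟩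
      α + β                       ≡⟨ α+β≡1 ⟩
      1#                          ∎

    S≤π : ∀ k u → S k u ≤ π u t
    S≤π k u = sup-upper (λ k → S k u) 1# (λ k → S≤1 k u) k

  πₜ : V → ℝ
  πₜ u = π u t

  -- One inequality bounds every partial sum. For the other, the supremum must be pulled out of the
  -- average: dividing by the positive weight `c` leaves a plain finite sum, to which `∑-sup-least`
  -- applies.
  π-equation : ∀ u → πₜ u ≡ source u + β * avg u πₜ
  π-equation u = ≤-antisym (sup-least _ _ S≤) (y≤z-x⇒x+y≤z (source u)
    (subst (_≤ πₜ u - source u) (sym (β*avg πₜ)) (subst (c * ∑ (outNbrs u) πₜ ≤_) (x*[x⁻¹*y]≡y _ c≢0)
      (*-monoʳ-≤ (<⇒≤ 0<c) (∑-sup-least S 1# S-mono-≤ S≤1 (outNbrs u) ∑S≤)))))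
    where
    S≤ : ∀ k → S k u ≤ source u + β * avg u πₜ
    S≤ k = begin
      S k u                         ≤⟨ S-mono-≤ (ℕ.n≤1+n k) u ⟩
      S (suc k) u                   ≡⟨ S-suc k u ⟩
      source u + β * avg u (S k)    ≤⟨ step-mono-≤ u (S≤π k) ⟩
      source u + β * avg u πₜ       ∎
    c = β * fromℕ (dₒᵤₜ u) ⁻¹
    0<c : 0# < c
    0<c = *-pos 0<β (0<⇒0<⁻¹ (0<dₒᵤₜ u))
    c≢0 = 0<⇒≢0 0<c
    β*avg : ∀ f → β * avg u f ≡ c * ∑ (outNbrs u) f
    β*avg f = trans (cong (β *_) (∑-*ˡ _ (outNbrs u) f)) (sym (*-assoc β _ _))
    ∑S≤ : ∀ k → ∑ (outNbrs u) (S k) ≤ c ⁻¹ * (πₜ u - source u)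
    ∑S≤ k = *-cancelˡ-≤ 0<c (subst₂ _≤_ (β*avg (S k)) (sym (x*[x⁻¹*y]≡y _ c≢0))
      (x+y≤z⇒y≤z-x (source u) (subst (_≤ πₜ u) (S-suc k u) (S≤π (suc k) u))))

  π-nonneg : ∀ u → 0# ≤ πₜ u
  π-nonneg u = subst (0# ≤_) (+-identityʳ _) (comparison α 0<α α<1 0# (λ _ → 0#) πₜ (λ w → begin
    0# + β * avg w πₜ                      ≤⟨ +-mono-≤ (source-nonneg w) ≤-refl ⟩
    source w + β * avg w πₜ                ≡⟨ π-equation w ⟨
    πₜ w                                   ≡⟨ trans (+-identityˡ _) (+-identityʳ _) ⟨
    0# + (πₜ w + 0#)
      ≡⟨ cong₂ (λ x y → x + (πₜ w + y)) (zeroʳ α) (trans (cong (β *_) (avg-const w 0#)) (zeroʳ β)) ⟨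
    α * 0# + (πₜ w + β * avg w (λ _ → 0#)) ∎) u)

  -- Local form of the invariant that `πₜ u` is `p u` plus the sum of `π u v * r v` over all `v`:
  -- `p` solves the equation of the contributions with the source lowered by `α * r`.
  Balanced : (p r : V → ℝ) → Set
  Balanced p r = ∀ u → p u + α * r u ≡ source u + β * avg u p

  module _ {p r} (bal : Balanced p r) (0≤r : ∀ u → 0# ≤ r u) where

    p≤π : ∀ u → p u ≤ πₜ u
    p≤π u = subst (p u ≤_) (+-identityʳ _) (comparison α 0<α α<1 0# p πₜ (λ w → begin
      p w + β * avg w πₜ                     ≤⟨ +-mono-≤ (x≤x+y (p w) (*-nonneg (<⇒≤ 0<α) (0≤r w))) ≤-refl ⟩
      p w + α * r w + β * avg w πₜ           ≡⟨ cong (_+ β * avg w πₜ) (bal w) ⟩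
      source w + β * avg w p + β * avg w πₜ
        ≡⟨ solve 3 (λ a b c → a :+ b :+ c := (a :+ c) :+ b) refl _ _ _ ⟩
      source w + β * avg w πₜ + β * avg w p  ≡⟨ cong (_+ β * avg w p) (π-equation w) ⟨
      πₜ w + β * avg w p
        ≡⟨ trans (cong (_+ (πₜ w + β * avg w p)) (zeroʳ α)) (+-identityˡ _) ⟨
      α * 0# + (πₜ w + β * avg w p)          ∎) u)

    π≤p+ε : ∀ {ε} → (∀ u → r u ≤ ε) → ∀ u → πₜ u ≤ p u + ε
    π≤p+ε {ε} r≤ε = comparison α 0<α α<1 ε πₜ p λ w → begin
      πₜ w + β * avg w p                     ≡⟨ cong (_+ β * avg w p) (π-equation w) ⟩
      source w + β * avg w πₜ + β * avg w p
        ≡⟨ solve 3 (λ a b c → a :+ b :+ c := (a :+ c) :+ b) refl _ _ _ ⟩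
      source w + β * avg w p + β * avg w πₜ  ≡⟨ cong (_+ β * avg w πₜ) (bal w) ⟨
      p w + α * r w + β * avg w πₜ
        ≡⟨ solve 3 (λ a b c → a :+ b :+ c := b :+ (a :+ c)) refl _ _ _ ⟩
      α * r w + (p w + β * avg w πₜ)         ≤⟨ +-mono-≤ (*-monoʳ-≤ (<⇒≤ 0<α) (r≤ε w)) ≤-refl ⟩
      α * ε + (p w + β * avg w πₜ)           ∎

  T : ℝ
  T = ∑ (allFin n) πₜ

  n*pageRank≡T : fromℕ n * pageRank t ≡ T
  n*pageRank≡T = x*[x⁻¹*y]≡y T (0<⇒≢0 (fromℕ-pos (n≢0 t)))
    where
    n≢0 : ∀ {k} → Fin k → k ≢ 0
    n≢0 {suc _} _ ()

  -- The walk of length 0 at `t` already contributes `α`. This keeps the bound on the running time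
  -- from falling below the constant overhead of the program.
  α≤T : α ≤ T
  α≤T = begin
    α                                 ≡⟨ *-identityʳ α ⟨
    α * 1#                            ≡⟨ cong (α *_) t≟t ⟨
    source t
      ≤⟨ x≤x+y _ (*-nonneg (<⇒≤ 0<β) (subst (_≤ avg t πₜ) (avg-const t 0#) (avg-mono-≤ t π-nonneg))) ⟩
    source t + β * avg t πₜ           ≡⟨ π-equation t ⟨
    πₜ t                              ≤⟨ term≤∑ π-nonneg (∈-allFin t) ⟩
    T                                 ∎
    where
    t≟t : ⟦ t ≟ᶠ t ⟧ ≡ 1#
    t≟t with t ≟ᶠ t
    ... | yes _  = refl
    ... | no t≢t = contradiction refl t≢t

  0≤T : 0# ≤ T
  0≤T = ≤-trans (<⇒≤ 0<α) α≤T

  -- Degree bounds for the total inflow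

  √m : ℝ
  √m = √ (fromℕ m)

  fromℕ-m≡∑dₒᵤₜ : fromℕ m ≡ ∑ (allFin n) (fromℕ ∘ dₒᵤₜ)
  fromℕ-m≡∑dₒᵤₜ = trans (fromℕ-length-filter (uncurry E?) (cartesianProduct (allFin n) (allFin n)))
    (trans (∑-cartesianProduct (allFin n) (allFin n) _)
      (∑-cong (allFin n) λ u → sym (fromℕ-length-filter (E? u) (allFin n))))

  1≤dₒᵤₜ : ∀ u → 1 ℕ.≤ dₒᵤₜ u
  1≤dₒᵤₜ u = ℕ.n≢0⇒n>0 (dₒᵤₜ≢0 u)

  child-exists : ∀ u → ∃[ w ] w ∈ outNbrs u
  child-exists u = from-length (outNbrs u) (1≤dₒᵤₜ u)
    where
    from-length : (xs : List V) → 1 ℕ.≤ length xs → ∃[ w ] w ∈ xs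
    from-length (x ∷ _) _ = x , here refl

  dₒᵤₜ≤Δₒᵤₜ : ∀ u → dₒᵤₜ u ℕ.≤ Δₒᵤₜ
  dₒᵤₜ≤Δₒᵤₜ u = All.lookup (xs≤max 0 (map dₒᵤₜ (allFin n))) (∈-map⁺ dₒᵤₜ (∈-allFin u))

  dᵢₙ≤Δᵢₙ : ∀ v → dᵢₙ v ℕ.≤ Δᵢₙ
  dᵢₙ≤Δᵢₙ v = All.lookup (xs≤max 0 (map dᵢₙ (allFin n))) (∈-map⁺ dᵢₙ (∈-allFin v))

  1≤Δₒᵤₜ : 1 ℕ.≤ Δₒᵤₜ
  1≤Δₒᵤₜ = ℕ.≤-trans (1≤dₒᵤₜ t) (dₒᵤₜ≤Δₒᵤₜ t)

  -- The target may have no parent, but it has a child, and the in-degree of that child is positive.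
  1≤Δᵢₙ : 1 ℕ.≤ Δᵢₙ
  1≤Δᵢₙ with w , w∈ ← child-exists t = ℕ.≤-trans
    (∈-length (∈-filter⁺ (λ u → E? u w) (∈-allFin t) (proj₂ (∈-filter⁻ (E? t) {xs = allFin n} w∈)))) (dᵢₙ≤Δᵢₙ w)

  √m*√m≡m : √m * √m ≡ fromℕ m
  √m*√m≡m = √-square (fromℕ-nonneg m)

  0≤√m : 0# ≤ √m
  0≤√m = √-nonneg (fromℕ-nonneg m)

  1≤√m : 1# ≤ √m
  1≤√m with 1# ≤? √m
  ... | yes 1≤√m = 1≤√m
  ... | no  1≰√m = contradiction (begin
    1#                                ≡⟨ fromℕ-1 ⟨
    fromℕ 1                           ≤⟨ fromℕ-mono-≤ (1≤dₒᵤₜ t) ⟩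
    fromℕ (dₒᵤₜ t)                    ≤⟨ term≤∑ (λ u → fromℕ-nonneg (dₒᵤₜ u)) (∈-allFin t) ⟩
    ∑ (allFin n) (fromℕ ∘ dₒᵤₜ)       ≡⟨ trans √m*√m≡m fromℕ-m≡∑dₒᵤₜ ⟨
    √m * √m                             ≤⟨ *-monoʳ-≤ 0≤√m (≰⇒≥ 1≰√m) ⟩
    √m * 1#                            ≡⟨ *-identityʳ √m ⟩
    √m                                 ∎) 1≰√m

  0<√m : 0# < √m
  0<√m = 0≤√m , λ 0≡√m → 0≢1 (≤-antisym 0≤1 (subst (1# ≤_) (sym 0≡√m) 1≤√m))

  inflow : ℝ
  inflow = ∑ (allFin n) λ v → πₜ v * fromℕ (dᵢₙ v)

  inflow≡ : inflow ≡ ∑ (allFin n) (λ u → ∑ (outNbrs u) πₜ)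
  inflow≡ = begin-equality
    inflow
      ≡⟨ ∑-cong (allFin n) (λ v → trans (cong (πₜ v *_) (fromℕ-length-filter (λ u → E? u v) (allFin n)))
           (sym (∑-*ˡ (πₜ v) (allFin n) _))) ⟩
    ∑ (allFin n) (λ v → ∑ (allFin n) λ u → πₜ v * ⟦ E? u v ⟧)
      ≡⟨ ∑-swap (allFin n) (allFin n) _ ⟩
    ∑ (allFin n) (λ u → ∑ (allFin n) λ v → πₜ v * ⟦ E? u v ⟧)
      ≡⟨ ∑-cong (allFin n) (λ u → trans (∑-cong (allFin n) λ v → *-comm (πₜ v) _) (sym (∑-filter (E? u) (allFin n) πₜ))) ⟩
    ∑ (allFin n) (λ u → ∑ (outNbrs u) πₜ) ∎

  -- Dropping the nonnegative source from the equation leaves `β * avg u πₜ ≤ πₜ u`.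
  β∑π≤dₒᵤₜπ : ∀ u → β * ∑ (outNbrs u) πₜ ≤ fromℕ (dₒᵤₜ u) * πₜ u
  β∑π≤dₒᵤₜπ u = begin
    β * ∑ (outNbrs u) πₜ                           ≡⟨ cong (β *_) (dₒᵤₜ*avg u πₜ) ⟨
    β * (fromℕ (dₒᵤₜ u) * avg u πₜ)
      ≡⟨ solve 3 (λ a b c → a :* (b :* c) := b :* (a :* c)) refl β _ _ ⟩
    fromℕ (dₒᵤₜ u) * (β * avg u πₜ)
      ≤⟨ *-monoʳ-≤ (fromℕ-nonneg (dₒᵤₜ u)) (x≤y+x _ (source-nonneg u)) ⟩
    fromℕ (dₒᵤₜ u) * (source u + β * avg u πₜ)     ≡⟨ cong (fromℕ (dₒᵤₜ u) *_) (π-equation u) ⟨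
    fromℕ (dₒᵤₜ u) * πₜ u                          ∎

  β*_≤ : ∀ {x} → 0# ≤ x → β * x ≤ x
  β*_≤ {x} 0≤x = subst (β * x ≤_) (*-identityˡ x) (*-monoˡ-≤ 0≤x
    (subst (β ≤_) α+β≡1 (x≤y+x β (<⇒≤ 0<α))))

  inflow-nonneg : 0# ≤ inflow
  inflow-nonneg = ∑-nonneg (allFin n) λ v → *-nonneg (π-nonneg v) (fromℕ-nonneg (dᵢₙ v))

  β*inflow≤Δᵢₙ : β * inflow ≤ fromℕ Δᵢₙ * T
  β*inflow≤Δᵢₙ = begin
    β * inflow                            ≤⟨ β*_≤ inflow-nonneg ⟩
    inflow
      ≤⟨ ∑-mono-≤ (allFin n) (λ v → *-monoʳ-≤ (π-nonneg v) (fromℕ-mono-≤ (dᵢₙ≤Δᵢₙ v))) ⟩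
    ∑ (allFin n) (λ v → πₜ v * fromℕ Δᵢₙ)  ≡⟨ trans (∑-*ʳ _ (allFin n) πₜ) (*-comm T _) ⟩
    fromℕ Δᵢₙ * T                         ∎

  β*inflow≡ : β * inflow ≡ ∑ (allFin n) λ u → β * ∑ (outNbrs u) πₜ
  β*inflow≡ = trans (cong (β *_) inflow≡) (sym (∑-*ˡ β (allFin n) _))

  β*inflow≤Δₒᵤₜ : β * inflow ≤ fromℕ Δₒᵤₜ * T
  β*inflow≤Δₒᵤₜ = begin
    β * inflow                                     ≡⟨ β*inflow≡ ⟩
    ∑ (allFin n) (λ u → β * ∑ (outNbrs u) πₜ)      ≤⟨ ∑-mono-≤ (allFin n) (λ u → ≤-trans (β∑π≤dₒᵤₜπ u)
                                                       (*-monoˡ-≤ (π-nonneg u) (fromℕ-mono-≤ (dₒᵤₜ≤Δₒᵤₜ u)))) ⟩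
    ∑ (allFin n) (λ u → fromℕ Δₒᵤₜ * πₜ u)         ≡⟨ ∑-*ˡ _ (allFin n) πₜ ⟩
    fromℕ Δₒᵤₜ * T                                 ∎

  heavy : V → ℝ
  heavy u with fromℕ (dₒᵤₜ u) ≤? √m
  ... | yes _ = 0#
  ... | no  _ = 1#

  -- At most m / √m nodes have out-degree above √m.
  ∑heavy≤√m : ∑ (allFin n) heavy ≤ √m
  ∑heavy≤√m = *-cancelˡ-≤ 0<√m (begin
    √m * ∑ (allFin n) heavy               ≡⟨ ∑-*ˡ √m (allFin n) heavy ⟨
    ∑ (allFin n) (λ u → √m * heavy u)     ≤⟨ ∑-mono-≤ (allFin n) √m*heavy≤ ⟩
    ∑ (allFin n) (fromℕ ∘ dₒᵤₜ)          ≡⟨ trans √m*√m≡m fromℕ-m≡∑dₒᵤₜ ⟨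
    √m * √m                                ∎)
    where
    √m*heavy≤ : ∀ u → √m * heavy u ≤ fromℕ (dₒᵤₜ u)
    √m*heavy≤ u with fromℕ (dₒᵤₜ u) ≤? √m
    ... | yes _ = subst (_≤ fromℕ (dₒᵤₜ u)) (sym (zeroʳ √m)) (fromℕ-nonneg (dₒᵤₜ u))
    ... | no  d≰√m = subst (_≤ fromℕ (dₒᵤₜ u)) (sym (*-identityʳ √m)) (≰⇒≥ d≰√m)

  β∑π≤ : ∀ u → β * ∑ (outNbrs u) πₜ ≤ √m * πₜ u + heavy u * T
  β∑π≤ u with fromℕ (dₒᵤₜ u) ≤? √m
  ... | yes d≤√m = begin
    β * ∑ (outNbrs u) πₜ     ≤⟨ β∑π≤dₒᵤₜπ u ⟩
    fromℕ (dₒᵤₜ u) * πₜ u    ≤⟨ *-monoˡ-≤ (π-nonneg u) d≤√m ⟩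
    √m * πₜ u                 ≡⟨ trans (cong (√m * πₜ u +_) (zeroˡ T)) (+-identityʳ _) ⟨
    √m * πₜ u + 0# * T        ∎
  ... | no _ = begin
    β * ∑ (outNbrs u) πₜ     ≤⟨ β*_≤ (∑-nonneg (outNbrs u) π-nonneg) ⟩
    ∑ (outNbrs u) πₜ         ≡⟨ ∑-filter (E? u) (allFin n) πₜ ⟩
    ∑ (allFin n) (λ v → ⟦ E? u v ⟧ * πₜ v)
                             ≤⟨ ∑-mono-≤ (allFin n) (λ v → subst (⟦ E? u v ⟧ * πₜ v ≤_) (*-identityˡ (πₜ v))
                                  (*-monoˡ-≤ (π-nonneg v) (⟦⟧≤1 (E? u v)))) ⟩
    T                        ≡⟨ *-identityˡ T ⟨
    1# * T                   ≤⟨ x≤y+x _ (*-nonneg 0≤√m (π-nonneg u)) ⟩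
    √m * πₜ u + 1# * T        ∎

  -- One summand collects `√m * πₜ u` over all nodes, the other at most `√m` heavy nodes at `T`
  -- each.
  β*inflow≤√m : β * inflow ≤ √m * T + √m * T
  β*inflow≤√m = begin
    β * inflow                                           ≡⟨ β*inflow≡ ⟩
    ∑ (allFin n) (λ u → β * ∑ (outNbrs u) πₜ)            ≤⟨ ∑-mono-≤ (allFin n) β∑π≤ ⟩
    ∑ (allFin n) (λ u → √m * πₜ u + heavy u * T)          ≡⟨ trans (∑-+ (allFin n) _ _)
                                                              (cong₂ _+_ (∑-*ˡ √m (allFin n) πₜ) (∑-*ʳ T (allFin n) heavy)) ⟩
    √m * T + ∑ (allFin n) heavy * T                       ≤⟨ +-monoʳ-≤ (√m * T) (*-monoˡ-≤ 0≤T ∑heavy≤√m) ⟩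
    √m * T + √m * T                                        ∎

  μ : ℝ
  μ = fromℕ Δᵢₙ ⊓ fromℕ Δₒᵤₜ ⊓ √m

  open MinOp (NaturalMin.minOperator totalOrder) using (⊓-sel)

  -- The minimum is one of its arguments, so `P` need not be monotone.
  ⊓-elim : (P : ℝ → Set) → ∀ {x y} → P x → P y → P (x ⊓ y)
  ⊓-elim P {x} {y} px py with ⊓-sel x y
  ... | inj₁ eq = subst P (sym eq) px
  ... | inj₂ eq = subst P (sym eq) py

  1≤μ : 1# ≤ μ
  1≤μ = ⊓-elim (1# ≤_) (⊓-elim (1# ≤_) (1≤fromℕ 1≤Δᵢₙ) (1≤fromℕ 1≤Δₒᵤₜ)) 1≤√m
    where
    1≤fromℕ : ∀ {k} → 1 ℕ.≤ k → 1# ≤ fromℕ k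
    1≤fromℕ {k} 1≤k = subst (_≤ fromℕ k) fromℕ-1 (fromℕ-mono-≤ 1≤k)

  -- The bound by `√m` comes with a factor 2, so the two degree bounds are doubled to give all three
  -- the same form.
  β*inflow≤μ : β * inflow ≤ μ * T + μ * T
  β*inflow≤μ = ⊓-elim P (⊓-elim P (double Δᵢₙ β*inflow≤Δᵢₙ) (double Δₒᵤₜ β*inflow≤Δₒᵤₜ)) β*inflow≤√m
    where
    P : ℝ → Set
    P x = β * inflow ≤ x * T + x * T
    double : ∀ k → β * inflow ≤ fromℕ k * T → P (fromℕ k)
    double k le = ≤-trans le (x≤x+y _ (*-nonneg (fromℕ-nonneg k) 0≤T))

-- The effect of a push and the bound on the total work

module Work (ℛ : Reals) (α : Reals.ℝ ℛ) (α∈⟨0,1⟩ : InUnitInterval ℛ α)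
            (G : Graph) (t : Graph.V G) where
  open Reals ℛ
  open Graph G
  open PageRank ℛ α G
  open OrderedFieldProperties orderedField
  open Averages ℛ G
  open Contributions ℛ α α∈⟨0,1⟩ G t
  open Solver using (solve; _:+_; _:*_; _:=_)
  open ≤-Reasoning

  potential : (V → ℝ) → ℝ
  potential p = ∑ (allFin n) λ v → p v * fromℕ (suc (dᵢₙ v))

  module _ (ε : ℝ) (ε∈⟨0,1⟩ : InUnitInterval ℛ ε) where

    private
      0<ε = proj₁ ε∈⟨0,1⟩
      ε<1 = proj₂ ε∈⟨0,1⟩

    budget : ℝ
    budget = (fromℕ n * pageRank t * ε ⁻¹) * μ

    ε*budget≡μ*T : ε * budget ≡ μ * T
    ε*budget≡μ*T = begin-equality
      ε * (fromℕ n * pageRank t * ε ⁻¹ * μ) ≡⟨ cong (λ x → ε * (x * ε ⁻¹ * μ)) n*pageRank≡T ⟩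
      ε * (T * ε ⁻¹ * μ)
        ≡⟨ solve 4 (λ a b c d → a :* ((b :* c) :* d) := (a :* c) :* (d :* b)) refl ε T (ε ⁻¹) μ ⟩
      ε * ε ⁻¹ * (μ * T)                    ≡⟨ cong (_* (μ * T)) (*-inverseʳ ε (0<⇒≢0 0<ε)) ⟩
      1# * (μ * T)                          ≡⟨ *-identityˡ _ ⟩
      μ * T                                 ∎

    T≤μ*T : T ≤ μ * T
    T≤μ*T = subst (_≤ μ * T) (*-identityˡ T) (*-monoˡ-≤ 0≤T 1≤μ)

    -- Lets the budget absorb the additive constant of the running time.
    α*β≤budget : α * β ≤ budget
    α*β≤budget = *-cancelˡ-≤ 0<ε (begin
      ε * (α * β)   ≤⟨ *-monoˡ-≤ (*-nonneg (<⇒≤ 0<α) (<⇒≤ 0<β)) (<⇒≤ ε<1) ⟩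
      1# * (α * β)  ≡⟨ trans (*-identityˡ _) (*-comm α β) ⟩
      β * α         ≤⟨ β*_≤ (<⇒≤ 0<α) ⟩
      α             ≤⟨ α≤T ⟩
      T             ≤⟨ T≤μ*T ⟩
      μ * T         ≡⟨ ε*budget≡μ*T ⟨
      ε * budget         ∎)

    -- The 3 is 1 for the total `T` of the contributions, coming from the 1 in `1 + dᵢₙ` and bounded
    -- by `1 ≤ μ`, and 2 for the inflow.
    work-bound : ∀ {p r} W → Balanced p r → (∀ u → 0# ≤ r u) → α * ε * fromℕ W ≤ potential p →
                 α * β * fromℕ W ≤ fromℕ 3 * budget
    work-bound {p} W bal 0≤r work≤ = *-cancelˡ-≤ 0<ε (begin
      ε * (α * β * fromℕ W)
        ≡⟨ solve 4 (λ e a b w → e :* ((a :* b) :* w) := b :* ((a :* e) :* w)) refl ε α β (fromℕ W) ⟩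
      β * (α * ε * fromℕ W)                  ≤⟨ *-monoʳ-≤ (<⇒≤ 0<β) work≤ ⟩
      β * potential p
        ≤⟨ *-monoʳ-≤ (<⇒≤ 0<β) (∑-mono-≤ (allFin n) λ v → *-monoˡ-≤ (fromℕ-nonneg (suc (dᵢₙ v))) (p≤π bal 0≤r v)) ⟩
      β * potential πₜ
        ≡⟨ cong (β *_) (trans
             (∑-cong (allFin n) λ v → trans (distribˡ (πₜ v) 1# _) (cong (_+ πₜ v * fromℕ (dᵢₙ v)) (*-identityʳ _)))
             (∑-+ (allFin n) πₜ _)) ⟩
      β * (T + inflow)                       ≡⟨ distribˡ β T inflow ⟩
      β * T + β * inflow                     ≤⟨ +-mono-≤ (≤-trans (β*_≤ 0≤T) T≤μ*T) β*inflow≤μ ⟩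
      μ * T + (μ * T + μ * T)                ≡⟨ cong (λ x → x + (x + x)) ε*budget≡μ*T ⟨
      ε * budget + (ε * budget + ε * budget)
        ≡⟨ solve 2 (λ e x → e :* x :+ (e :* x :+ e :* x) := e :* (x :+ (x :+ x))) refl ε budget ⟩
      ε * (budget + (budget + budget))
        ≡⟨ cong (λ x → ε * (budget + (budget + x))) (+-identityʳ budget) ⟨
      ε * (budget + (budget + (budget + 0#)))
        -- Any list of length 3 would do: a constant sum over it unfolds to the threefold sum.
        ≡⟨ cong (ε *_) (∑-const (0 ∷ 1 ∷ 2 ∷ []) budget) ⟩
      ε * (fromℕ 3 * budget)                      ∎)

  module _ {p p′ : V → ℝ} {v x} (p′≡ : ∀ u → p′ u ≡ p u + α * x * ⟦ u ≟ᶠ v ⟧) where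

    -- `r₀` is the residue with the entry at `v` cleared. Comparing both residues with it covers
    -- self-loops, where `v` receives a share back. The `α * x` gained by `p` at `v` replaces the
    -- residue lost there, and the shares passed to the parents match the growth of `β * avg u p`.
    push-balanced : ∀ {r r′ r₀ : V → ℝ} → (∀ u → r u ≡ r₀ u + x * ⟦ u ≟ᶠ v ⟧) →
                    (∀ u → r′ u ≡ r₀ u + β * x * fromℕ (dₒᵤₜ u) ⁻¹ * ⟦ E? u v ⟧) →
                    Balanced p r → Balanced p′ r′
    push-balanced {r} {r′} {r₀} r≡ r′≡ bal u = begin-equality
      p′ u + α * r′ u
        ≡⟨ cong₂ (λ a b → a + α * b) (p′≡ u) (r′≡ u) ⟩
      p u + α * x * δ + α * (r₀ u + β * x * d⁻¹ * e)
        ≡⟨ solve 8 (λ p a x δ r b d e → p :+ a :* x :* δ :+ a :* (r :+ b :* x :* d :* e) :=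
             p :+ a :* (r :+ x :* δ) :+ b :* (a :* x :* (d :* e))) refl (p u) α x δ (r₀ u) β d⁻¹ e ⟩
      p u + α * (r₀ u + x * δ) + β * (α * x * (d⁻¹ * e))
        ≡⟨ cong (λ a → p u + α * a + β * (α * x * (d⁻¹ * e))) (r≡ u) ⟨
      p u + α * r u + β * (α * x * (d⁻¹ * e))
        ≡⟨ cong₂ (λ a b → a + β * (α * x * b)) (bal u) (sym (avg-≟ u v)) ⟩
      source u + β * avg u p + β * (α * x * avg u (λ w → ⟦ w ≟ᶠ v ⟧))
        ≡⟨ solve 4 (λ s b f g → s :+ b :* f :+ b :* g := s :+ b :* (f :+ g)) refl _ β _ _ ⟩
      source u + β * (avg u p + α * x * avg u (λ w → ⟦ w ≟ᶠ v ⟧))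
        ≡⟨ cong (λ a → source u + β * (avg u p + a)) (avg-*ˡ u (α * x) _) ⟨
      source u + β * (avg u p + avg u (λ w → α * x * ⟦ w ≟ᶠ v ⟧))
        ≡⟨ cong (λ a → source u + β * a) (trans (avg-cong u p′≡) (avg-+ u p _)) ⟨
      source u + β * avg u p′ ∎
      where
      δ = ⟦ u ≟ᶠ v ⟧
      e = ⟦ E? u v ⟧
      d⁻¹ = fromℕ (dₒᵤₜ u) ⁻¹

    push-potential : ∀ {ε} W → ε ≤ x → α * ε * fromℕ W ≤ potential p →
                     α * ε * fromℕ (W ℕ.+ suc (dᵢₙ v)) ≤ potential p′
    push-potential {ε} W ε≤x work≤ = begin
      α * ε * fromℕ (W ℕ.+ suc (dᵢₙ v))
        ≡⟨ trans (cong (α * ε *_) (fromℕ-+ W _)) (distribˡ (α * ε) _ _) ⟩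
      α * ε * fromℕ W + α * ε * c v
        ≤⟨ +-mono-≤ work≤ (*-monoˡ-≤ (fromℕ-nonneg (suc (dᵢₙ v))) (*-monoʳ-≤ (<⇒≤ 0<α) ε≤x)) ⟩
      potential p + α * x * c v
        ≡⟨ cong (potential p +_) (∑-δ _≟ᶠ_ (λ u → α * x * c u) (allFin⁺ n) (∈-allFin v)) ⟨
      potential p + ∑ (allFin n) (λ u → α * x * c u * ⟦ u ≟ᶠ v ⟧)
                                                   ≡⟨ ∑-+ (allFin n) _ _ ⟨
      ∑ (allFin n) (λ u → p u * c u + α * x * c u * ⟦ u ≟ᶠ v ⟧)
        ≡⟨ ∑-cong (allFin n) (λ u → trans (cong (_* c u) (p′≡ u))
             (solve 4 (λ p ax c δ → (p :+ ax :* δ) :* c := p :* c :+ ax :* c :* δ) refl (p u) (α * x) (c u) _)) ⟨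
      potential p′                                 ∎
      where
      c : V → ℝ
      c u = fromℕ (suc (dᵢₙ u))

-- Array updates and the program

does-true : ∀ {P : Set} (P? : Dec P) → does P? ≡ true → P
does-true (yes p) _ = p

does-false : ∀ {P : Set} (P? : Dec P) → does P? ≡ false → ¬ P
does-false (no ¬p) _ = ¬p

module _ {A : Set} (mem : ℕ → ℕ → A) (a : ℕ) {i j : ℕ} {x : A} where

  update-≡ : j ≡ i → update mem a i x a j ≡ x
  update-≡ j≡i rewrite dec-true ((a ℕ.≟ a) ×-dec (j ℕ.≟ i)) (refl , j≡i) = refl

  update-≢ : j ≢ i → update mem a i x a j ≡ mem a j
  update-≢ j≢i rewrite dec-false ((a ℕ.≟ a) ×-dec (j ℕ.≟ i)) (j≢i ∘ proj₂) = refl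

drop-lookup : ∀ {A : Set} (xs : List A) (k : Fin (length xs)) →
              drop (toℕ k) xs ≡ lookup xs k ∷ drop (suc (toℕ k)) xs
drop-lookup (x ∷ xs) zero    = refl
drop-lookup (x ∷ xs) (suc k) = drop-lookup xs k

-- Integer arrays: 0 the target, 1 the queue, 2 its head, 3 its tail, 4 the
-- current node, 5 the number of its parents still to be visited, 6 a parent
-- and 7 the out-degree of that parent.  Real arrays: 0 the parameters,
-- 1 the residues, 2 the reserves, 3 the amount to be distributed.

spread : Cmd
spread =
  -- Decremented before use: the counter of remaining parents thereby becomes the index, from 0, of
  -- the next one.
  setInt 5 (lit 0) (int 5 (lit 0) ⊖ lit 1) ⨾
  parent 6 (lit 0) (int 4 (lit 0)) (int 5 (lit 0)) ⨾
  outdeg 7 (lit 0) (int 6 (lit 0)) ⨾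
  setReal 1 (int 6 (lit 0)) (real 1 (int 6 (lit 0)) ⊕ real 3 (lit 0) ⊘ ofInt (int 7 (lit 0))) ⨾
  -- Enqueued whatever its residue, and possibly again; the test in `process` sorts this out.
  setInt 1 (int 3 (lit 0)) (int 6 (lit 0)) ⨾
  setInt 3 (lit 0) (int 3 (lit 0) ⊕ lit 1)

spreadTest : Test
spreadTest = lit 1 ≤ⁱ int 5 (lit 0)

push : Cmd
push =
  setReal 3 (lit 0) (real 1 (int 4 (lit 0))) ⨾
  -- Cleared before the parents are visited, so that the share of a self-loop is not lost.
  setReal 1 (int 4 (lit 0)) (ofInt (lit 0)) ⨾
  setReal 2 (int 4 (lit 0)) (real 2 (int 4 (lit 0)) ⊕ real 0 (lit 1) ⊗ real 3 (lit 0)) ⨾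
  setReal 3 (lit 0) ((ofInt (lit 1) ⊖ real 0 (lit 1)) ⊗ real 3 (lit 0)) ⨾
  indeg 5 (lit 0) (int 4 (lit 0)) ⨾
  while spreadTest spread

process : Cmd
process =
  setInt 4 (lit 0) (int 1 (int 2 (lit 0))) ⨾
  setInt 2 (lit 0) (int 2 (lit 0) ⊕ lit 1) ⨾
  ifThenElse (real 1 (int 4 (lit 0)) ≤ʳ real 0 (lit 0)) skip push

processTest : Test
processTest = int 2 (lit 0) ⊕ lit 1 ≤ⁱ int 3 (lit 0)

-- The cells below the tail contain every node that was ever given a residue, hence every node with
-- a nonzero reserve. They are read backwards, using the tail as the counter.
report : Cmd
report =
  setInt 3 (lit 0) (int 3 (lit 0) ⊖ lit 1) ⨾
  setInt 4 (lit 0) (int 1 (int 3 (lit 0))) ⨾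
  ifThenElse (real 2 (int 4 (lit 0)) ≤ʳ ofInt (lit 0)) skip
    (write (int 4 (lit 0)) (real 2 (int 4 (lit 0))) ⨾
     setReal 2 (int 4 (lit 0)) (ofInt (lit 0)))

reportTest : Test
reportTest = lit 1 ≤ⁱ int 3 (lit 0)

backwardPush : Cmd
backwardPush =
  setReal 1 (int 0 (lit 0)) (ofInt (lit 1)) ⨾
  setInt 1 (lit 0) (int 0 (lit 0)) ⨾
  setInt 3 (lit 0) (lit 1) ⨾
  while processTest process ⨾
  while reportTest report

-- `spreadCost` and `skipCost` are the exact costs of the loop bodies without the loop test,
-- `pushCost` that of a pushing `process` up to its inner loop. `reportCost` is the larger of the
-- two branches and includes the test of its loop.
spreadCost skipCost pushCost reportCost visitCost discardCost : ℕ
spreadCost = 40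
skipCost   = 18
pushCost   = 53
reportCost = 32
visitCost   = tcost spreadTest ℕ.+ spreadCost
discardCost = tcost processTest ℕ.+ skipCost

-- `c₀` prepays discarding and reporting the initial entry. `c₁` pays for one unit of work, which is
-- either the fixed part of a push or one visited parent together with the later handling of its
-- entry; for simplicity it is the sum of both.
c₀ c₁ c₂ : ℕ
c₀ = discardCost ℕ.+ reportCost
c₁ = pushCost ℕ.+ (tcost processTest ℕ.+ tcost spreadTest ℕ.+ visitCost ℕ.+ discardCost ℕ.+ reportCost)
-- 23 accounts for the initialisation and for the final tests of the two loops.
c₂ = 23 ℕ.+ c₀

-- A loop rule with cost

module Programs (ℛ : Reals) {G : Graph} (A : Access G) where
  open Machine ℛ
  open Execution A
  open ℕ.≤-Reasoning

  -- The invariant carries the cost so far. Each iteration adds at least the positive cost of its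
  -- test, so `suc N` units of fuel cannot run out while the invariant keeps the cost within `N`.
  -- The failing last test is not counted in `l`, hence the extra `tcost b`.
  while-rule : ∀ b c (I : State → ℕ → Set) N → (∀ {σ k} → I σ k → k ℕ.≤ N) →
    (∀ {σ k} → I σ k → teval σ b ≡ true →
       Σ[ τ ∈ State ] Σ[ j ∈ ℕ ] ⟨ c , σ ⟩⇓[ j ] τ × I τ (k ℕ.+ (tcost b ℕ.+ j))) →
    ∀ {σ k} → I σ k →
    Σ[ τ ∈ State ] Σ[ j ∈ ℕ ] Σ[ l ∈ ℕ ]
      ⟨ while b c , σ ⟩⇓[ j ] τ × I τ l × teval τ b ≡ false × k ℕ.+ j ≡ l ℕ.+ tcost b
  while-rule b c I N bound step {k = k} inv = go (suc N) inv (ℕ.m≤n+m (suc N) k)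
    where
    0<tcost : ∀ b → 0 ℕ.< tcost b
    0<tcost (_ ≤ⁱ _) = ℕ.z<s
    0<tcost (_ ≤ʳ _) = ℕ.z<s
    0<tcost (neg _)  = ℕ.z<s
    go : ∀ fuel {σ k} → I σ k → N ℕ.< k ℕ.+ fuel →
      Σ[ τ ∈ State ] Σ[ j ∈ ℕ ] Σ[ l ∈ ℕ ]
        ⟨ while b c , σ ⟩⇓[ j ] τ × I τ l × teval τ b ≡ false × k ℕ.+ j ≡ l ℕ.+ tcost b
    go zero {k = k} inv N<k = contradiction (bound inv) (ℕ.<⇒≱ (subst (N ℕ.<_) (ℕ.+-identityʳ k) N<k))
    go (suc fuel) {σ} {k} inv N<k with teval σ b in eq
    ... | false = σ , tcost b , k , while-false eq , inv , eq , refl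
    ... | true with ρ , i , run , inv′ ← step inv eq
      with τ , j , l , run′ , inv″ , eq′ , time ← go fuel inv′ (begin-strict
        N                               <⟨ N<k ⟩
        k ℕ.+ suc fuel                  ≡⟨ ℕ.+-assoc k 1 fuel ⟨
        k ℕ.+ 1 ℕ.+ fuel
          ≤⟨ ℕ.+-monoˡ-≤ fuel (ℕ.+-monoʳ-≤ k (ℕ.≤-trans (0<tcost b) (ℕ.m≤m+n _ i))) ⟩
        k ℕ.+ (tcost b ℕ.+ i) ℕ.+ fuel  ∎) =
      τ , tcost b ℕ.+ i ℕ.+ j , l , while-true eq run run′ , inv″ , eq′ ,
      trans (sym (ℕ.+-assoc k (tcost b ℕ.+ i) j)) time

-- Queue invariants and the inner loop

module Correctness (ℛ : Reals) (α : Reals.ℝ ℛ) (α∈⟨0,1⟩ : InUnitInterval ℛ α)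
                   {G : Graph} (A : Access G) (t : Graph.V G)
                   (ε : Reals.ℝ ℛ) (ε∈⟨0,1⟩ : InUnitInterval ℛ ε) where
  open Reals ℛ
  open Graph G
  open Access A
  open PageRank ℛ α G
  open OrderedFieldProperties orderedField
  open Averages ℛ G
  open Contributions ℛ α α∈⟨0,1⟩ G t
  open Work ℛ α α∈⟨0,1⟩ G t
  open Machine ℛ
  open Execution A
  open Programs ℛ A
  open Solver using (solve; _:+_; _:*_; _:=_)

  private
    0<ε = proj₁ ε∈⟨0,1⟩

  head tail : State → ℕ
  head σ = ints σ 2 0
  tail σ = ints σ 3 0

  residue reserve : State → V → ℝ
  residue σ v = reals σ 1 (toℕ v)
  reserve σ v = reals σ 2 (toℕ v)

  Queued : (ℕ → ℕ) → ℕ → ℕ → V → Set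
  Queued Q lo hi v = ∃[ j ] lo ℕ.≤ j × j ℕ.< hi × Q j ≡ toℕ v

  Nodes : (ℕ → ℕ) → ℕ → Set
  Nodes Q hi = ∀ {j} → j ℕ.< hi → Σ[ v ∈ V ] Q j ≡ toℕ v

  module _ (mem : ℕ → ℕ → ℕ) (a : ℕ) {hi : ℕ} {v : V} where

    private
      Q = update mem a hi (toℕ v) a
      hi<hi+1 : hi ℕ.< hi ℕ.+ 1
      hi<hi+1 = ℕ.≤-reflexive (ℕ.+-comm 1 hi)

    enqueue-Nodes : Nodes (mem a) hi → Nodes Q (hi ℕ.+ 1)
    enqueue-Nodes nodes {j} j<hi+1 with j ℕ.≟ hi
    ... | yes j≡hi = v , update-≡ mem a j≡hi
    ... | no  j≢hi with w , eq ← nodes (ℕ.≤∧≢⇒< (ℕ.m<1+n⇒m≤n (subst (j ℕ.<_) (ℕ.+-comm hi 1) j<hi+1)) j≢hi) =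
      w , trans (update-≢ mem a j≢hi) eq

    enqueue-old : ∀ {lo w} → Queued (mem a) lo hi w → Queued Q lo (hi ℕ.+ 1) w
    enqueue-old (j , lo≤j , j<hi , eq) =
      j , lo≤j , ℕ.<-trans j<hi hi<hi+1 , trans (update-≢ mem a (ℕ.<⇒≢ j<hi)) eq

    enqueue-new : ∀ {lo} → lo ℕ.≤ hi → Queued Q lo (hi ℕ.+ 1) v
    enqueue-new lo≤hi = hi , lo≤hi , hi<hi+1 , update-≡ mem a refl

  record Inv (σ : State) : Set where
    field
      param-ε : reals σ 0 0 ≡ ε
      param-α : reals σ 0 1 ≡ α
      no-output : output σ ≡ []
      head≤tail : head σ ℕ.≤ tail σ
      nodes : Nodes (ints σ 1) (tail σ)
      residue-nonneg : ∀ v → 0# ≤ residue σ v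
      reserve-nonneg : ∀ v → 0# ≤ reserve σ v
      -- Large residues must still be waiting, from the head on; reserves only need some cell below
      -- the tail, processed or not.
      residue-queued : ∀ v → residue σ v ≤ ε ⊎ Queued (ints σ 1) (head σ) (tail σ) v
      reserve-queued : ∀ v → reserve σ v ≡ 0# ⊎ Queued (ints σ 1) 0 (tail σ) v

  -- `p` and `r` are the values on entering the loop, `e` is the tail on leaving it. Parents are
  -- visited from the last to the first, so with `d` of them remaining, `drop d (parents v)` has
  -- been served.
  record Spreading (v : V) (y : ℝ) (p r : V → ℝ) (h e d : ℕ) (σ : State) : Set where
    field
      inv : Inv σ
      remaining : ints σ 5 0 ≡ d
      current : ints σ 4 0 ≡ toℕ v
      amount : reals σ 3 0 ≡ y
      reserve≡ : ∀ u → reserve σ u ≡ p u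
      residue≡ : ∀ u → residue σ u ≡
        r u + y * fromℕ (dₒᵤₜ u) ⁻¹ * ∑ (drop d (parents v)) (λ w → ⟦ w ≟ᶠ u ⟧)
      head≡ : head σ ≡ h
      tail≡ : tail σ ℕ.+ d ≡ e

  spread-once : ∀ {v y p r h e d σ} → 0# ≤ y → d ℕ.< length (parents v) → Spreading v y p r h e (suc d) σ →
                Σ[ τ ∈ State ] ⟨ spread , σ ⟩⇓[ spreadCost ] τ × Spreading v y p r h e d τ
  spread-once {v} {y} {p} {r} {h} {e} {d} {σ} 0≤y d<len S = _ ,
    (setInt ⨾ parent v k S.current remaining′ ⨾ outdeg u refl ⨾ setReal ⨾ setInt ⨾ setInt) , record
      { inv = record
        { param-ε = param-ε
        ; param-α = param-α
        ; no-output = no-output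
        ; head≤tail = ℕ.≤-trans head≤tail (ℕ.m≤m+n _ 1)
        ; nodes = enqueue-Nodes (ints σ) 1 nodes
        ; residue-nonneg = residue-nonneg′
        ; reserve-nonneg = reserve-nonneg
        ; residue-queued = residue-queued′
        ; reserve-queued = map₂ (enqueue-old (ints σ) 1) ∘ reserve-queued
        }
      ; remaining = cong (ℕ._∸ 1) S.remaining
      ; current = S.current
      ; amount = S.amount
      ; reserve≡ = S.reserve≡
      ; residue≡ = residue≡′
      ; head≡ = S.head≡
      ; tail≡ = trans (ℕ.+-assoc (tail σ) 1 d) S.tail≡
      }
    where
    module S = Spreading S
    open Inv S.inv
    k = fromℕ< d<len
    u = lookup (parents v) k
    remaining′ : ints σ 5 0 ℕ.∸ 1 ≡ toℕ k
    remaining′ = trans (cong (ℕ._∸ 1) S.remaining) (sym (toℕ-fromℕ< d<len))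
    mem = update (reals σ) 1 (toℕ u) (residue σ u + reals σ 3 0 * fromℕ (dₒᵤₜ u) ⁻¹)
    residue-at : mem 1 (toℕ u) ≡ residue σ u + y * fromℕ (dₒᵤₜ u) ⁻¹
    residue-at = trans (update-≡ (reals σ) 1 refl) (cong (λ z → residue σ u + z * fromℕ (dₒᵤₜ u) ⁻¹) S.amount)
    residue-off : ∀ {w} → u ≢ w → mem 1 (toℕ w) ≡ residue σ w
    residue-off u≢w = update-≢ (reals σ) 1 (u≢w ∘ sym ∘ toℕ-injective)
    drop≡ : drop d (parents v) ≡ u ∷ drop (suc d) (parents v)
    drop≡ = subst (λ i → drop i (parents v) ≡ u ∷ drop (suc i) (parents v)) (toℕ-fromℕ< d<len)
      (drop-lookup (parents v) k)
    residue-nonneg′ : ∀ w → 0# ≤ mem 1 (toℕ w)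
    residue-nonneg′ w with u ≟ᶠ w
    ... | yes refl = subst (0# ≤_) (sym residue-at)
      (+-nonneg (residue-nonneg u) (*-nonneg 0≤y (0<⇒0≤⁻¹ (0<dₒᵤₜ u))))
    ... | no  u≢w = subst (0# ≤_) (sym (residue-off u≢w)) (residue-nonneg w)
    residue-queued′ : ∀ w → mem 1 (toℕ w) ≤ ε ⊎
      Queued (update (ints σ) 1 (tail σ) (toℕ u) 1) (head σ) (tail σ ℕ.+ 1) w
    residue-queued′ w with u ≟ᶠ w
    ... | yes refl = inj₂ (enqueue-new (ints σ) 1 head≤tail)
    ... | no  u≢w with residue-queued w
    ...   | inj₁ le = inj₁ (subst (_≤ ε) (sym (residue-off u≢w)) le)
    ...   | inj₂ q  = inj₂ (enqueue-old (ints σ) 1 q)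
    residue≡′ : ∀ w → mem 1 (toℕ w) ≡
      r w + y * fromℕ (dₒᵤₜ w) ⁻¹ * ∑ (drop d (parents v)) (λ x → ⟦ x ≟ᶠ w ⟧)
    residue≡′ w rewrite drop≡ with u ≟ᶠ w
    ... | yes refl = trans residue-at (trans (cong (_+ y * fromℕ (dₒᵤₜ u) ⁻¹) (S.residue≡ u))
      (trans (cong (r u + c * s +_) (sym (*-identityʳ c)))
        (solve 4 (λ r c s o → r :+ c :* s :+ c :* o := r :+ c :* (o :+ s)) refl (r u) c s 1#)))
      where
      c = y * fromℕ (dₒᵤₜ u) ⁻¹
      s = ∑ (drop (suc d) (parents v)) (λ x → ⟦ x ≟ᶠ u ⟧)
    ... | no  u≢w = trans (residue-off u≢w) (trans (S.residue≡ w)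
      (cong (λ z → r w + y * fromℕ (dₒᵤₜ w) ⁻¹ * z) (sym (+-identityˡ _))))

  -- Here the number of iterations is known, so induction on it suffices. The 4 is the failing last
  -- test.
  spread-all : ∀ {v y p r h e} → 0# ≤ y → ∀ d {σ} → d ℕ.≤ length (parents v) → Spreading v y p r h e d σ →
               Σ[ τ ∈ State ] ⟨ while spreadTest spread , σ ⟩⇓[ d ℕ.* visitCost ℕ.+ 4 ] τ ×
                 Spreading v y p r h e 0 τ
  spread-all 0≤y zero {σ} _ S = σ , while-false (dec-false (1 ℕ.≤? ints σ 5 0) λ 1≤ →
    contradiction (subst (1 ℕ.≤_) (Spreading.remaining S) 1≤) λ ()) , S
  spread-all 0≤y (suc d) {σ} d<len S
    with ρ , run , S′ ← spread-once 0≤y d<len S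
    with τ , run′ , S″ ← spread-all 0≤y d (ℕ.<⇒≤ d<len) S′ =
    τ , while-true (dec-true (1 ℕ.≤? ints σ 5 0) (subst (1 ℕ.≤_) (sym (Spreading.remaining S)) ℕ.z<s)) run run′ , S″

  -- Amortised analysis of the main loop

  record Main (σ : State) (k : ℕ) : Set where
    field
      inv : Inv σ
      balanced : Balanced (reserve σ) (residue σ)
      rest : ℕ
      -- The sum of 1 + dᵢₙ over the pushes made so far.
      work : ℕ
      tail≡ : head σ ℕ.+ rest ≡ tail σ
      -- Besides the elapsed cost `k`, each waiting entry holds the price of discarding it, and each
      -- entry ever made holds the price of reporting it.
      cost≤ : k ℕ.+ (discardCost ℕ.* rest ℕ.+ reportCost ℕ.* tail σ) ℕ.≤ c₀ ℕ.+ c₁ ℕ.* work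
      work≤ : α * ε * fromℕ work ≤ potential (reserve σ)

  module Process {σ k} (M : Main σ k) (nonempty : head σ ℕ.+ 1 ℕ.≤ tail σ) where
    open Main M
    open Inv inv
    open ℕSolver.+-*-Solver using () renaming (solve to ℕsolve; _:+_ to _⊹_; _:*_ to _⋆_; _:=_ to _≔_; con to lit′)

    Q : ℕ → ℕ
    Q = ints σ 1

    head<tail : head σ ℕ.< tail σ
    head<tail = subst (ℕ._≤ tail σ) (ℕ.+-comm (head σ) 1) nonempty

    v : V
    v = proj₁ (nodes head<tail)

    Q≡v : Q (head σ) ≡ toℕ v
    Q≡v = proj₂ (nodes head<tail)

    rest-suc : ∃[ rest′ ] rest ≡ suc rest′
    rest-suc with rest | tail≡
    ... | zero  | eq = contradiction (trans (sym (ℕ.+-identityʳ _)) eq) (ℕ.<⇒≢ head<tail)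
    ... | suc r | _  = r , refl

    rest′ : ℕ
    rest′ = proj₁ rest-suc

    head′+rest′≡tail : head σ ℕ.+ 1 ℕ.+ rest′ ≡ tail σ
    head′+rest′≡tail = trans (ℕ.+-assoc (head σ) 1 rest′)
      (trans (cong (head σ ℕ.+_) (sym (proj₂ rest-suc))) tail≡)

    cost≤′ : k ℕ.+ (discardCost ℕ.* suc rest′ ℕ.+ reportCost ℕ.* tail σ) ℕ.≤ c₀ ℕ.+ c₁ ℕ.* work
    cost≤′ = subst (λ r → k ℕ.+ (discardCost ℕ.* r ℕ.+ reportCost ℕ.* tail σ) ℕ.≤ c₀ ℕ.+ c₁ ℕ.* work) (proj₂ rest-suc) cost≤

    -- The cell that leaves the queue holds `v`, so it cannot be the witness for another node.
    still-queued : ∀ u → u ≢ v → residue σ u ≤ ε ⊎ Queued Q (head σ ℕ.+ 1) (tail σ) u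
    still-queued u u≢v with residue-queued u
    ... | inj₁ le = inj₁ le
    ... | inj₂ (j , head≤j , j<tail , eq) = inj₂ (j , head+1≤j , j<tail , eq)
      where
      head+1≤j : head σ ℕ.+ 1 ℕ.≤ j
      head+1≤j = subst (ℕ._≤ j) (ℕ.+-comm 1 (head σ)) (ℕ.≤∧≢⇒< head≤j λ head≡j →
        u≢v (toℕ-injective (trans (sym eq) (trans (cong Q (sym head≡j)) Q≡v))))

    σ₁ : State
    σ₁ = putInt (putInt σ 4 (lit 0) (Q (head σ))) 2 (lit 0) (head σ ℕ.+ 1)

    skipping : residue σ v ≤ ε → ⟨ process , σ ⟩⇓[ skipCost ] σ₁ × Main σ₁ (k ℕ.+ (7 ℕ.+ skipCost))
    skipping r≤ε = (setInt ⨾ setInt ⨾ if-true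
        (dec-true (_ ≤? _) (subst₂ _≤_ (cong (reals σ 1) (sym Q≡v)) (sym param-ε) r≤ε)) skip) , record
      { inv = record
        { param-ε = param-ε
        ; param-α = param-α
        ; no-output = no-output
        ; head≤tail = nonempty
        ; nodes = nodes
        ; residue-nonneg = residue-nonneg
        ; reserve-nonneg = reserve-nonneg
        ; residue-queued = residue-queued′
        ; reserve-queued = reserve-queued
        }
      ; balanced = balanced
      ; rest = rest′
      ; work = work
      ; tail≡ = head′+rest′≡tail
      -- The `discardCost` held by the dequeued entry pays exactly for the loop test, 7, and for
      -- `skipCost`.
      ; cost≤ = subst (ℕ._≤ c₀ ℕ.+ c₁ ℕ.* work)
          (ℕsolve 4 (λ k r c d → k ⊹ (c ⋆ (lit′ 1 ⊹ r) ⊹ d) ≔ k ⊹ c ⊹ (c ⋆ r ⊹ d))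
            refl k rest′ discardCost (reportCost ℕ.* tail σ)) cost≤′
      ; work≤ = work≤
      }
      where
      residue-queued′ : ∀ u → residue σ u ≤ ε ⊎ Queued Q (head σ ℕ.+ 1) (tail σ) u
      residue-queued′ u with u ≟ᶠ v
      ... | yes refl = inj₁ r≤ε
      ... | no  u≢v  = still-queued u u≢v

    module Pushing (r≰ε : ¬ residue σ v ≤ ε) where

      a₁ a₂ a₃ a₄ σ₂ : State
      a₁ = putReal σ₁ 3 (lit 0) (reval σ₁ (real 1 (int 4 (lit 0))))
      a₂ = putReal a₁ 1 (int 4 (lit 0)) 0#
      a₃ = putReal a₂ 2 (int 4 (lit 0)) (reval a₂ (real 2 (int 4 (lit 0)) ⊕ real 0 (lit 1) ⊗ real 3 (lit 0)))
      a₄ = putReal a₃ 3 (lit 0) (reval a₃ ((ofInt (lit 1) ⊖ real 0 (lit 1)) ⊗ real 3 (lit 0)))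
      σ₂ = putInt a₄ 5 (lit 0) (dᵢₙ v)

      x y : ℝ
      x = residue σ v
      y = reals σ₂ 3 0

      ε≤x : ε ≤ x
      ε≤x = ≰⇒≥ r≰ε

      0≤x : 0# ≤ x
      0≤x = residue-nonneg v

      y≡ : y ≡ β * x
      y≡ = cong₂ _*_ (cong₂ _-_ fromℕ-1 param-α) (cong (reals σ 1) Q≡v)

      residue₂-v : residue σ₂ v ≡ 0#
      residue₂-v = update-≡ (reals σ) 1 (sym Q≡v)

      residue₂-≢ : ∀ {u} → u ≢ v → residue σ₂ u ≡ residue σ u
      residue₂-≢ u≢v = update-≢ (reals σ) 1 λ eq → u≢v (toℕ-injective (trans eq Q≡v))

      -- Makes `residue σ₂` the `r₀` of `push-balanced`.
      residue≡ : ∀ u → residue σ u ≡ residue σ₂ u + x * ⟦ u ≟ᶠ v ⟧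
      residue≡ u with u ≟ᶠ v
      ... | yes refl = sym (trans (cong₂ _+_ residue₂-v (*-identityʳ x)) (+-identityˡ x))
      ... | no  u≢v  = sym (trans (cong₂ _+_ (residue₂-≢ u≢v) (zeroʳ x)) (+-identityʳ _))

      reserve₂≡ : ∀ u → reserve σ₂ u ≡ reserve σ u + α * x * ⟦ u ≟ᶠ v ⟧
      reserve₂≡ u with u ≟ᶠ v
      ... | yes refl = trans (update-≡ (reals σ) 2 (sym Q≡v)) (cong₂ _+_ (cong (reals σ 2) Q≡v)
        (trans (cong₂ _*_ param-α (cong (reals σ 1) Q≡v)) (sym (*-identityʳ (α * x)))))
      ... | no  u≢v  = trans (update-≢ (reals σ) 2 λ eq → u≢v (toℕ-injective (trans eq Q≡v)))
        (sym (trans (cong (reserve σ u +_) (zeroʳ (α * x))) (+-identityʳ _)))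

      inv₂ : Inv σ₂
      inv₂ = record
        { param-ε = param-ε
        ; param-α = param-α
        ; no-output = no-output
        ; head≤tail = nonempty
        ; nodes = nodes
        ; residue-nonneg = residue-nonneg₂
        ; reserve-nonneg = λ u → subst (0# ≤_) (sym (reserve₂≡ u))
            (+-nonneg (reserve-nonneg u) (*-nonneg (*-nonneg (<⇒≤ 0<α) 0≤x) (⟦⟧-nonneg (u ≟ᶠ v))))
        ; residue-queued = residue-queued₂
        ; reserve-queued = reserve-queued₂
        }
        where
        residue-nonneg₂ : ∀ u → 0# ≤ residue σ₂ u
        residue-nonneg₂ u with u ≟ᶠ v
        ... | yes refl = subst (0# ≤_) (sym residue₂-v) ≤-refl
        ... | no  u≢v  = subst (0# ≤_) (sym (residue₂-≢ u≢v)) (residue-nonneg u)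
        residue-queued₂ : ∀ u → residue σ₂ u ≤ ε ⊎ Queued Q (head σ ℕ.+ 1) (tail σ) u
        residue-queued₂ u with u ≟ᶠ v
        ... | yes refl = inj₁ (subst (_≤ ε) (sym residue₂-v) (<⇒≤ 0<ε))
        ... | no  u≢v with still-queued u u≢v
        ...   | inj₁ le = inj₁ (subst (_≤ ε) (sym (residue₂-≢ u≢v)) le)
        ...   | inj₂ q  = inj₂ q
        reserve-queued₂ : ∀ u → reserve σ₂ u ≡ 0# ⊎ Queued Q 0 (tail σ) u
        reserve-queued₂ u with u ≟ᶠ v
        -- The cell just dequeued serves as witness: it precedes the new head but is still below the
        -- tail.
        ... | yes refl = inj₂ (head σ , ℕ.z≤n , head<tail , Q≡v)
        ... | no  u≢v with reserve-queued u
        ...   | inj₁ eq = inj₁ (trans (update-≢ (reals σ) 2 λ eq → u≢v (toℕ-injective (trans eq Q≡v))) eq)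
        ...   | inj₂ q  = inj₂ q

      deg : ℕ
      deg = dᵢₙ v

      length-parents : length (parents v) ≡ deg
      length-parents = ↭-length (parents↭ v)

      spreading₂ : Spreading v y (reserve σ₂) (residue σ₂) (head σ ℕ.+ 1) (tail σ ℕ.+ deg) deg σ₂
      spreading₂ = record
        { inv = inv₂
        ; remaining = refl
        ; current = Q≡v
        ; amount = refl
        ; reserve≡ = λ _ → refl
        ; residue≡ = λ u → sym (trans (cong (λ z → residue σ₂ u + y * fromℕ (dₒᵤₜ u) ⁻¹ * z)
            (cong (λ ps → ∑ ps (λ w → ⟦ w ≟ᶠ u ⟧)) (drop-all deg (parents v) (ℕ.≤-reflexive length-parents))))
            (trans (cong (residue σ₂ u +_) (zeroʳ _)) (+-identityʳ _)))
        ; head≡ = refl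
        ; tail≡ = refl
        }

      spreading : Σ[ τ ∈ State ] ⟨ while spreadTest spread , σ₂ ⟩⇓[ deg ℕ.* visitCost ℕ.+ 4 ] τ ×
                    Spreading v y (reserve σ₂) (residue σ₂) (head σ ℕ.+ 1) (tail σ ℕ.+ deg) 0 τ
      spreading = spread-all (subst (0# ≤_) (sym y≡) (*-nonneg (<⇒≤ 0<β) 0≤x)) deg
        (ℕ.≤-reflexive (sym length-parents)) spreading₂

      τ : State
      τ = proj₁ spreading

      pushing : ⟨ process , σ ⟩⇓[ pushCost ℕ.+ (deg ℕ.* visitCost ℕ.+ 4) ] τ ×
                  Main τ (k ℕ.+ (7 ℕ.+ (pushCost ℕ.+ (deg ℕ.* visitCost ℕ.+ 4))))
      pushing = (setInt ⨾ setInt ⨾ if-false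
          (dec-false (_ ≤? _) (r≰ε ∘ subst₂ _≤_ (cong (reals σ 1) Q≡v) param-ε))
          (setReal ⨾ setReal ⨾ setReal ⨾ setReal ⨾ indeg v Q≡v ⨾ proj₁ (proj₂ spreading))) , record
        { inv = S.inv
        ; balanced = push-balanced reserve′≡ residue≡ residue′≡ balanced
        ; rest = rest′ ℕ.+ deg
        ; work = work ℕ.+ suc deg
        ; tail≡ = trans (cong (ℕ._+ (rest′ ℕ.+ deg)) S.head≡)
            (trans (sym (ℕ.+-assoc (head σ ℕ.+ 1) rest′ deg)) (trans (cong (ℕ._+ deg) head′+rest′≡tail) (sym tail′≡)))
        ; cost≤ = subst (λ e → k ℕ.+ (7 ℕ.+ (pushCost ℕ.+ (deg ℕ.* visitCost ℕ.+ 4))) ℕ.+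
            (discardCost ℕ.* (rest′ ℕ.+ deg) ℕ.+ reportCost ℕ.* e) ℕ.≤ c₀ ℕ.+ c₁ ℕ.* (work ℕ.+ suc deg)) (sym tail′≡) cost≤″
        ; work≤ = push-potential reserve′≡ work ε≤x work≤
        }
        where
        module S = Spreading (proj₂ (proj₂ spreading))
        tail′≡ : tail τ ≡ tail σ ℕ.+ deg
        tail′≡ = trans (sym (ℕ.+-identityʳ _)) S.tail≡
        reserve′≡ : ∀ u → reserve τ u ≡ reserve σ u + α * x * ⟦ u ≟ᶠ v ⟧
        reserve′≡ u = trans (S.reserve≡ u) (reserve₂≡ u)
        residue′≡ : ∀ u → residue τ u ≡ residue σ₂ u + β * x * fromℕ (dₒᵤₜ u) ⁻¹ * ⟦ E? u v ⟧
        residue′≡ u = trans (S.residue≡ u) (cong₂ (λ a b → residue σ₂ u + a * fromℕ (dₒᵤₜ u) ⁻¹ * b) y≡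
          (trans (∑-↭ _ (parents↭ v)) (∑-inNbrs-≟ u v)))
        open ℕ.≤-Reasoning
        cost≤″ : k ℕ.+ (7 ℕ.+ (pushCost ℕ.+ (deg ℕ.* visitCost ℕ.+ 4))) ℕ.+
            (discardCost ℕ.* (rest′ ℕ.+ deg) ℕ.+ reportCost ℕ.* (tail σ ℕ.+ deg)) ℕ.≤ c₀ ℕ.+ c₁ ℕ.* (work ℕ.+ suc deg)
        cost≤″ = begin
          -- The added term is the surplus of `c₁ * suc deg`, together with the released
          -- `discardCost`, over the actual expense. The 11 is the test of the main loop, 7, plus
          -- the last test of the inner one, 4.
          _ ≤⟨ ℕ.m≤m+n _ (visitCost ℕ.+ 2 ℕ.* discardCost ℕ.+ reportCost ℕ.+ (pushCost ℕ.+ 11) ℕ.* deg) ⟩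
          _ ≡⟨ ℕsolve 6 (λ k p d r c e →
                 k ⊹ (lit′ 7 ⊹ (p ⊹ (d ⋆ lit′ visitCost ⊹ lit′ 4))) ⊹ (lit′ discardCost ⋆ (r ⊹ d) ⊹ c ⋆ (e ⊹ d)) ⊹
                   (lit′ (visitCost ℕ.+ 2 ℕ.* discardCost) ⊹ c ⊹ (p ⊹ lit′ 11) ⋆ d) ≔
                 k ⊹ (lit′ discardCost ⋆ (lit′ 1 ⊹ r) ⊹ c ⋆ e) ⊹
                   (p ⊹ (lit′ (11 ℕ.+ visitCost ℕ.+ discardCost) ⊹ c)) ⋆ (lit′ 1 ⊹ d))
                 refl k pushCost deg rest′ reportCost (tail σ) ⟩
          k ℕ.+ (discardCost ℕ.* suc rest′ ℕ.+ reportCost ℕ.* tail σ) ℕ.+ c₁ ℕ.* suc deg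
            ≤⟨ ℕ.+-monoˡ-≤ (c₁ ℕ.* suc deg) cost≤′ ⟩
          c₀ ℕ.+ c₁ ℕ.* work ℕ.+ c₁ ℕ.* suc deg
            ≡⟨ trans (ℕ.+-assoc c₀ (c₁ ℕ.* work) (c₁ ℕ.* suc deg)) (cong (c₀ ℕ.+_) (sym (ℕ.*-distribˡ-+ c₁ work (suc deg)))) ⟩
          c₀ ℕ.+ c₁ ℕ.* (work ℕ.+ suc deg) ∎

  process-once : ∀ {σ k} → Main σ k → teval σ processTest ≡ true →
                 Σ[ τ ∈ State ] Σ[ j ∈ ℕ ] ⟨ process , σ ⟩⇓[ j ] τ × Main τ (k ℕ.+ (7 ℕ.+ j))
  process-once {σ} {k} M nonempty = go (residue σ v ≤? ε)
    where
    open Process M (does-true (head σ ℕ.+ 1 ℕ.≤? tail σ) nonempty)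
    go : Dec (residue σ v ≤ ε) →
         Σ[ τ ∈ State ] Σ[ j ∈ ℕ ] ⟨ process , σ ⟩⇓[ j ] τ × Main τ (k ℕ.+ (7 ℕ.+ j))
    go (yes r≤ε) = σ₁ , skipCost , skipping r≤ε
    go (no  r≰ε) = τ , pushCost ℕ.+ (deg ℕ.* visitCost ℕ.+ 4) , pushing
      where open Pushing r≰ε

  -- Reporting the reserves

  -- A reserve is cleared when it is written, so that a node occurring several
  -- times in the queue is reported once; p records the original reserves.
  record Reporting (p : V → ℝ) (i : ℕ) (σ : State) : Set where
    field
      tail≡ : tail σ ≡ i
      nodes : Nodes (ints σ 1) i
      support : List V
      unique : Unique support
      output≡ : output σ ≡ map (λ v → toℕ v , p v) support
      reserve-nonneg : ∀ v → 0# ≤ reserve σ v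
      written : ∀ v → (v ∈ support × reserve σ v ≡ 0#) ⊎ (v ∉ support × reserve σ v ≡ p v)
      reserve-queued : ∀ v → reserve σ v ≡ 0# ⊎ Queued (ints σ 1) 0 i v

  report-once : ∀ {p i σ} → Reporting p (suc i) σ →
                Σ[ τ ∈ State ] Σ[ j ∈ ℕ ] ⟨ report , σ ⟩⇓[ j ] τ × Reporting p i τ × 4 ℕ.+ j ℕ.≤ reportCost
  report-once {p} {i} {σ} R = go (reserve σ v ≤? 0#)
    where
    open Reporting R
    q : ℕ
    q = ints σ 1 (tail σ ℕ.∸ 1)
    v : V
    v = proj₁ (nodes (ℕ.n<1+n i))
    q≡v : q ≡ toℕ v
    q≡v = trans (cong (λ j → ints σ 1 (j ℕ.∸ 1)) tail≡) (proj₂ (nodes (ℕ.n<1+n i)))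
    still-queued : ∀ u → u ≢ v → reserve σ u ≡ 0# ⊎ Queued (ints σ 1) 0 i u
    still-queued u u≢v with reserve-queued u
    ... | inj₁ eq = inj₁ eq
    ... | inj₂ (j , _ , j<1+i , eq) = inj₂ (j , ℕ.z≤n , ℕ.≤∧≢⇒< (ℕ.m<1+n⇒m≤n j<1+i) j≢i , eq)
      where
      j≢i : j ≢ i
      j≢i refl = u≢v (toℕ-injective (trans (sym eq) (proj₂ (nodes (ℕ.n<1+n i)))))
    go : Dec (reserve σ v ≤ 0#) →
         Σ[ τ ∈ State ] Σ[ j ∈ ℕ ] ⟨ report , σ ⟩⇓[ j ] τ × Reporting p i τ × 4 ℕ.+ j ℕ.≤ reportCost
    go (yes p≤0) = _ , _ , (setInt ⨾ setInt ⨾ if-true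
        (dec-true (_ ≤? _) (subst (λ j → reals σ 2 j ≤ 0#) (sym q≡v) p≤0)) skip) , record
      { tail≡ = cong (ℕ._∸ 1) tail≡
      ; nodes = nodes ∘ ℕ.m<n⇒m<1+n
      ; support = support
      ; unique = unique
      ; output≡ = output≡
      ; reserve-nonneg = reserve-nonneg
      ; written = written
      ; reserve-queued = reserve-queued′
      } , ℕ.m≤m+n _ _
      where
      reserve-queued′ : ∀ u → reserve σ u ≡ 0# ⊎ Queued (ints σ 1) 0 i u
      reserve-queued′ u with u ≟ᶠ v
      ... | yes refl = inj₁ (≤-antisym p≤0 (reserve-nonneg v))
      ... | no  u≢v  = still-queued u u≢v
    go (no p≰0) = _ , _ , (setInt ⨾ setInt ⨾ if-false
        (dec-false (_ ≤? _) (p≰0 ∘ subst (λ j → reals σ 2 j ≤ 0#) q≡v)) (write ⨾ setReal)) , record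
      { tail≡ = cong (ℕ._∸ 1) tail≡
      ; nodes = nodes ∘ ℕ.m<n⇒m<1+n
      ; support = v ∷ support
      ; unique = ¬Any⇒All¬ support (proj₁ v-unwritten) ∷ unique
      ; output≡ = cong₂ _∷_ (cong₂ _,_ q≡v (trans (cong (reals σ 2) q≡v) (proj₂ v-unwritten))) output≡
      ; reserve-nonneg = reserve-nonneg′
      ; written = written′
      ; reserve-queued = reserve-queued′
      } , ℕ.≤-refl
      where
      v-unwritten : v ∉ support × reserve σ v ≡ p v
      v-unwritten with written v
      ... | inj₁ (_ , p≡0) = contradiction (≤-reflexive p≡0) p≰0
      ... | inj₂ w = w
      reserve′ : V → ℝ
      reserve′ u = update (reals σ) 2 q 0# 2 (toℕ u)
      reserve′-v : reserve′ v ≡ 0#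
      reserve′-v = update-≡ (reals σ) 2 (sym q≡v)
      reserve′-≢ : ∀ {u} → u ≢ v → reserve′ u ≡ reserve σ u
      reserve′-≢ u≢v = update-≢ (reals σ) 2 λ eq → u≢v (toℕ-injective (trans eq q≡v))
      reserve-nonneg′ : ∀ u → 0# ≤ reserve′ u
      reserve-nonneg′ u with u ≟ᶠ v
      ... | yes refl = subst (0# ≤_) (sym reserve′-v) ≤-refl
      ... | no  u≢v  = subst (0# ≤_) (sym (reserve′-≢ u≢v)) (reserve-nonneg u)
      written′ : ∀ u → (u ∈ v ∷ support × reserve′ u ≡ 0#) ⊎ (u ∉ v ∷ support × reserve′ u ≡ p u)
      written′ u with u ≟ᶠ v
      ... | yes refl = inj₁ (here refl , reserve′-v)
      ... | no  u≢v with written u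
      ...   | inj₁ (u∈ , eq) = inj₁ (there u∈ , trans (reserve′-≢ u≢v) eq)
      ...   | inj₂ (u∉ , eq) = inj₂ ((λ { (here u≡v) → u≢v u≡v ; (there u∈) → u∉ u∈ }) , trans (reserve′-≢ u≢v) eq)
      reserve-queued′ : ∀ u → reserve′ u ≡ 0# ⊎ Queued (ints σ 1) 0 i u
      reserve-queued′ u with u ≟ᶠ v
      ... | yes refl = inj₁ reserve′-v
      ... | no  u≢v with still-queued u u≢v
      ...   | inj₁ eq = inj₁ (trans (reserve′-≢ u≢v) eq)
      ...   | inj₂ qd = inj₂ qd

  report-all : ∀ {p} i {σ} → Reporting p i σ →
               Σ[ τ ∈ State ] Σ[ j ∈ ℕ ] ⟨ while reportTest report , σ ⟩⇓[ j ] τ × Reporting p 0 τ ×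
                 j ℕ.≤ reportCost ℕ.* i ℕ.+ 4
  report-all zero {σ} R = σ , _ , while-false (dec-false (1 ℕ.≤? tail σ) λ 1≤ →
    contradiction (subst (1 ℕ.≤_) (Reporting.tail≡ R) 1≤) λ ()) , R , ℕ.m≤n+m 4 (reportCost ℕ.* 0)
  report-all (suc i) {σ} R
    with ρ , j , run , R′ , j≤ ← report-once R
    with τ , l , run′ , R″ , l≤ ← report-all i R′ =
    τ , _ , while-true (dec-true (1 ℕ.≤? tail σ) (subst (1 ℕ.≤_) (sym (Reporting.tail≡ R)) ℕ.z<s)) run run′ , R″ ,
    subst (4 ℕ.+ j ℕ.+ l ℕ.≤_)
      (trans (sym (ℕ.+-assoc reportCost _ 4)) (cong (ℕ._+ 4) (sym (ℕ.*-suc reportCost i))))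
      (ℕ.+-mono-≤ j≤ l≤)

  -- With no queue cell left, a node that was not written has reserve zero, and that reserve is
  -- still its original one.
  represents : ∀ {p σ} → Reporting p 0 σ → Represents (output σ) p
  represents {p} {σ} R = support , unique , output≡ , λ v v∉ → unwritten v v∉ (written v) (reserve-queued v)
    where
    open Reporting R
    unwritten : ∀ v → v ∉ support → (v ∈ support × reserve σ v ≡ 0#) ⊎ (v ∉ support × reserve σ v ≡ p v) →
                reserve σ v ≡ 0# ⊎ Queued (ints σ 1) 0 0 v → p v ≡ 0#
    unwritten v v∉ (inj₁ (v∈ , _)) _         = contradiction v∈ v∉
    unwritten v v∉ (inj₂ (_ , eq)) (inj₁ eq′) = trans (sym eq) eq′
    unwritten v v∉ _               (inj₂ (_ , _ , () , _))

  -- Initial state, termination and total cost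

  start : State
  start = putInt (putInt (putReal (initial (toℕ t) ε α) 1 (int 0 (lit 0)) (fromℕ 1)) 1 (lit 0) (toℕ t)) 3 (lit 0) 1

  residue-start : ∀ u → residue start u ≡ ⟦ u ≟ᶠ t ⟧
  residue-start u with u ≟ᶠ t
  ... | yes refl = trans (update-≡ (reals (initial (toℕ t) ε α)) 1 {toℕ t} refl) fromℕ-1
  ... | no  u≢t  = update-≢ (reals (initial (toℕ t) ε α)) 1 (u≢t ∘ toℕ-injective)

  main-start : Main start 0
  main-start = record
    { inv = record
      { param-ε = refl
      ; param-α = refl
      ; no-output = refl
      ; head≤tail = ℕ.z≤n
      ; nodes = λ { {zero} _ → t , refl ; {suc _} (ℕ.s≤s ()) }
      ; residue-nonneg = λ u → subst (0# ≤_) (sym (residue-start u)) (⟦⟧-nonneg (u ≟ᶠ t))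
      ; reserve-nonneg = λ _ → ≤-refl
      ; residue-queued = queued
      ; reserve-queued = λ _ → inj₁ refl
      }
    ; balanced = λ u → trans (+-identityˡ _) (trans (cong (α *_) (residue-start u))
        (sym (trans (cong (source u +_) (trans (cong (β *_) (avg-const u 0#)) (zeroʳ β))) (+-identityʳ _))))
    ; rest = 1
    ; work = 0
    ; tail≡ = refl
    -- `c₀` is exactly what the single entry `t` holds. The cost of reaching `start` is added in
    -- `total-time`.
    ; cost≤ = ℕ.m≤m+n _ _
    ; work≤ = subst (_≤ potential (λ _ → 0#)) (sym (zeroʳ (α * ε)))
        (∑-nonneg (allFin n) λ u → *-nonneg ≤-refl (fromℕ-nonneg (suc (dᵢₙ u))))
    }
    where
    queued : ∀ u → residue start u ≤ ε ⊎ Queued (ints start 1) 0 1 u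
    queued u with u ≟ᶠ t
    ... | yes refl = inj₂ (0 , ℕ.z≤n , ℕ.z<s , refl)
    ... | no  u≢t  = inj₁ (subst (_≤ ε) (sym (update-≢ (reals (initial (toℕ t) ε α)) 1 (u≢t ∘ toℕ-injective))) (<⇒≤ 0<ε))

  0<α*β : 0# < α * β
  0<α*β = *-pos 0<α 0<β

  main-work-bound : ∀ {σ k} (M : Main σ k) → α * β * fromℕ (Main.work M) ≤ fromℕ 3 * budget ε ε∈⟨0,1⟩
  main-work-bound M = work-bound ε ε∈⟨0,1⟩ work balanced residue-nonneg work≤
    where
    open Main M
    open Inv inv

  -- The cost bound also serves as the termination argument.
  time-limit : ∃[ N ] (∀ {σ k} → Main σ k → k ℕ.≤ N)
  -- The real bound on the work is rounded up to a natural number, as `while-rule` needs a limit for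
  -- the natural-number cost.
  time-limit with w , w-limit ← archimedean ((α * β) ⁻¹ * (fromℕ 3 * budget ε ε∈⟨0,1⟩)) =
    c₀ ℕ.+ c₁ ℕ.* w , λ {σ} {k} M → begin
      k                              ≤⟨ ℕ.m≤m+n k _ ⟩
      _                              ≤⟨ Main.cost≤ M ⟩
      c₀ ℕ.+ c₁ ℕ.* Main.work M
        ≤⟨ ℕ.+-monoʳ-≤ c₀ (ℕ.*-monoʳ-≤ c₁ (fromℕ-cancel-≤ {Main.work M} {w} (≤-trans
        (*-cancelˡ-≤ 0<α*β (subst (α * β * fromℕ (Main.work M) ≤_)
          (sym (x*[x⁻¹*y]≡y _ (0<⇒≢0 0<α*β))) (main-work-bound M))) w-limit))) ⟩
      c₀ ℕ.+ c₁ ℕ.* w                ∎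
    where open ℕ.≤-Reasoning

  module Finished {σ k} (M : Main σ k) (done : teval σ processTest ≡ false) where
    open Main M
    open Inv inv

    tail≤head : tail σ ℕ.≤ head σ
    tail≤head = ℕ.m<1+n⇒m≤n (subst (tail σ ℕ.<_) (ℕ.+-comm (head σ) 1)
      (ℕ.≰⇒> (does-false (head σ ℕ.+ 1 ℕ.≤? tail σ) done)))

    residue≤ε : ∀ u → residue σ u ≤ ε
    residue≤ε u with residue-queued u
    ... | inj₁ le = le
    ... | inj₂ (j , head≤j , j<tail , _) = contradiction (ℕ.≤-trans tail≤head head≤j) (ℕ.<⇒≱ j<tail)

    error≤ε : ∀ u → ∣ reserve σ u - π u t ∣ ≤ ε
    error≤ε u = ∣x-y∣≤z (≤-trans (p≤π balanced residue-nonneg u) (x≤x+y _ (<⇒≤ 0<ε)))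
      (π≤p+ε balanced residue-nonneg residue≤ε u)

    reporting : Reporting (reserve σ) (tail σ) σ
    reporting = record
      { tail≡ = refl
      ; nodes = nodes
      ; support = []
      ; unique = []
      ; output≡ = no-output
      ; reserve-nonneg = reserve-nonneg
      ; written = λ v → inj₂ ((λ ()) , refl)
      ; reserve-queued = reserve-queued
      }

  -- Multiplied by `α * β`, the constant part is absorbed by `α*β≤budget` and the work by three
  -- budgets, so the factor in front depends on `α` alone.
  time-bound : ∀ {σ k} (M : Main σ k) {time} → time ℕ.≤ c₂ ℕ.+ c₁ ℕ.* Main.work M →
               fromℕ time ≤ (α * β) ⁻¹ * fromℕ (c₂ ℕ.+ c₁ ℕ.* 3) * budget ε ε∈⟨0,1⟩
  time-bound M {time} time≤ = *-cancelˡ-≤ 0<α*β (begin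
    γ * fromℕ time                                 ≤⟨ *-monoʳ-≤ (<⇒≤ 0<α*β) (fromℕ-mono-≤ time≤) ⟩
    γ * fromℕ (c₂ ℕ.+ c₁ ℕ.* W)
      ≡⟨ cong (γ *_) (trans (fromℕ-+ c₂ (c₁ ℕ.* W)) (cong (fromℕ c₂ +_) (fromℕ-* c₁ W))) ⟩
    γ * (fromℕ c₂ + fromℕ c₁ * fromℕ W)
      ≡⟨ solve 4 (λ g a b w → g :* (a :+ b :* w) := a :* g :+ b :* (g :* w))
         refl γ (fromℕ c₂) (fromℕ c₁) (fromℕ W) ⟩
    fromℕ c₂ * γ + fromℕ c₁ * (γ * fromℕ W)
      ≤⟨ +-mono-≤ (*-monoʳ-≤ (fromℕ-nonneg c₂) (α*β≤budget ε ε∈⟨0,1⟩))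
                                                       (*-monoʳ-≤ (fromℕ-nonneg c₁) (main-work-bound M)) ⟩
    fromℕ c₂ * x + fromℕ c₁ * (fromℕ 3 * x)
      ≡⟨ solve 4 (λ a b c x → a :* x :+ b :* (c :* x) := (a :+ b :* c) :* x)
         refl (fromℕ c₂) (fromℕ c₁) (fromℕ 3) x ⟩
    (fromℕ c₂ + fromℕ c₁ * fromℕ 3) * x
      ≡⟨ cong (_* x) (trans (fromℕ-+ c₂ (c₁ ℕ.* 3)) (cong (fromℕ c₂ +_) (fromℕ-* c₁ 3))) ⟨
    fromℕ (c₂ ℕ.+ c₁ ℕ.* 3) * x                    ≡⟨ x*[x⁻¹*y]≡y _ (0<⇒≢0 0<α*β) ⟨
    γ * (γ ⁻¹ * (fromℕ (c₂ ℕ.+ c₁ ℕ.* 3) * x))     ≡⟨ cong (γ *_) (*-assoc (γ ⁻¹) _ x) ⟨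
    γ * (γ ⁻¹ * fromℕ (c₂ ℕ.+ c₁ ℕ.* 3) * x)       ∎)
    where
    open ≤-Reasoning
    γ = α * β
    W = Main.work M
    x = budget ε ε∈⟨0,1⟩

  -- The 12 is the cost of the initialisation. The report needs no new estimate: `cost≤` has held
  -- its price in reserve from the start.
  total-time : ∀ {σ k} (M : Main σ k) {j l} → j ≡ k ℕ.+ 7 → l ℕ.≤ reportCost ℕ.* tail σ ℕ.+ 4 →
               12 ℕ.+ (j ℕ.+ l) ℕ.≤ c₂ ℕ.+ c₁ ℕ.* Main.work M
  total-time {σ} {k} M {_} {l} refl l≤ = begin
    12 ℕ.+ (k ℕ.+ 7 ℕ.+ l)                             ≤⟨ ℕ.+-monoʳ-≤ 12 (ℕ.+-monoʳ-≤ (k ℕ.+ 7) l≤) ⟩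
    12 ℕ.+ (k ℕ.+ 7 ℕ.+ (r ℕ.+ 4))
      ≡⟨ ℕsolve 2 (λ k r → lit′ 12 ⊹ (k ⊹ lit′ 7 ⊹ (r ⊹ lit′ 4)) ≔ lit′ 23 ⊹ (k ⊹ r)) refl k r ⟩
    23 ℕ.+ (k ℕ.+ r)
      ≤⟨ ℕ.+-monoʳ-≤ 23 (ℕ.+-monoʳ-≤ k (ℕ.m≤n+m r (discardCost ℕ.* rest))) ⟩
    23 ℕ.+ (k ℕ.+ (discardCost ℕ.* rest ℕ.+ r))                 ≤⟨ ℕ.+-monoʳ-≤ 23 cost≤ ⟩
    23 ℕ.+ (c₀ ℕ.+ c₁ ℕ.* work)                        ≡⟨ ℕ.+-assoc 23 c₀ (c₁ ℕ.* work) ⟨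
    c₂ ℕ.+ c₁ ℕ.* work                                 ∎
    where
    open Main M
    open ℕ.≤-Reasoning
    open ℕSolver.+-*-Solver using () renaming (solve to ℕsolve; _:+_ to _⊹_; _:=_ to _≔_; con to lit′)
    r = reportCost ℕ.* tail σ

  correct : Σ[ τ ∈ State ] Σ[ time ∈ ℕ ]
    ( ⟨ backwardPush , initial (toℕ t) ε α ⟩⇓[ time ] τ
    × ApproximatesContributions (output τ) t ε
    × fromℕ time ≤ (α * β) ⁻¹ * fromℕ (c₂ ℕ.+ c₁ ℕ.* 3) * budget ε ε∈⟨0,1⟩)
  correct = finish (while-rule processTest process Main (proj₁ time-limit) (proj₂ time-limit) process-once main-start)
    where
    finish : Σ[ σ ∈ State ] Σ[ j ∈ ℕ ] Σ[ k ∈ ℕ ]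
               ⟨ while processTest process , start ⟩⇓[ j ] σ × Main σ k × teval σ processTest ≡ false × j ≡ k ℕ.+ 7 → _
    finish (σ , j , k , run , M , done , j≡)
      with τ , l , run′ , R , l≤ ← report-all (tail σ) (Finished.reporting M done) =
      τ , 12 ℕ.+ (j ℕ.+ l) , (setReal ⨾ setInt ⨾ setInt ⨾ run ⨾ run′) ,
      (reserve σ , represents R , Finished.error≤ε M done) , time-bound M (total-time M j≡ l≤)

theorem1p1 : (ℛ : Reals) (let open Reals ℛ) (let open Machine ℛ)
    (α : ℝ) → 0# < α → α < 1# →
    Σ[ algorithm ∈ Cmd ] Σ[ C ∈ ℝ ]
    ((G : Graph) (let open Graph G) (let open PageRank ℛ α G)
    (A : Access G) (let open Execution A) (t : V) (ε : ℝ) → 0# < ε → ε < 1# →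
    Σ[ final ∈ State ] Σ[ time ∈ ℕ ]
    ( ⟨ algorithm , initial (toℕ t) ε α ⟩⇓[ time ] final
    × ApproximatesContributions (output final) t ε
    × fromℕ time ≤ C * ((fromℕ n * pageRank t * ε ⁻¹)
    * (fromℕ Δᵢₙ ⊓ fromℕ Δₒᵤₜ ⊓ √ (fromℕ m)))))
theorem1p1 ℛ α 0<α α<1 = backwardPush , (α * (1# - α)) ⁻¹ * fromℕ (c₂ ℕ.+ c₁ ℕ.* 3) ,
  λ G A t ε 0<ε ε<1 → Correctness.correct ℛ α (0<α , α<1) A t ε (0<ε , ε<1)
  where open Reals ℛ
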